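{- There is a function $\varepsilon$ defined on the even integers $n \ge 4$ with $\varepsilon(n)\to 0$ as $n\to\infty$ such that for every even integer $n\geq 4$, \[\left(\frac{\sqrt{2}}{2}+\varepsilon(n)\right)\sqrt{n}\ \leq\ r_{\mathrm{odd}}(n,C_n)\ \leq\ \frac{3\sqrt{2}}{2}\sqrt{n}.\]
   Context: Graphs are finite and simple. For graphs $G,H$, the odd-Ramsey number $r_{\mathrm{odd}}(G,H)$ is the minimum positive integer $r$ for which there is an edge-colouring of $G$ with $r$ colours (not required to be proper) such that every copy of $H$ in $G$ (subgraph of $G$ isomorphic to $H$) contains an odd number of edges of at least one colour. Write $r_{\mathrm{odd}}(n,H)=r_{\mathrm{odd}}(K_n,H)$. $C_n$ denotes the cycle on $n$ vertices, so copies of $C_n$ in $K_n$ are Hamilton cycles. -}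

module Defs where

open import Data.Bool using (Bool; false; T)
open import Data.Bool.Properties using (T?)
open import Data.Fin using (Fin; toℕ)
import Data.Fin as Fin
import Data.Fin.Properties as Fin
open import Data.Fin.Subset using (Subset; _∈_)
import Data.Integer as ℤ
import Data.Integer.Properties as ℤ
open import Data.Integer using (+_; +[1+_])
open import Data.List using (length; filter; cartesianProduct; allFin)
open import Data.Nat as ℕ using (ℕ; zero; suc; s≤s; z≤n)
import Data.Nat.Properties as ℕ
open import Data.Nat.Divisibility using (_∣_)
open import Data.Nat.Solver using (module +-*-Solver)
open import Data.Product using (Σ; ∃-syntax; _×_; _,_)
open import Data.Rational as ℚ using (ℚ; mkℚ; 0ℚ; 1ℚ; ½; 1/_; _/_)
import Data.Rational.Properties as ℚ
import Data.Rational.Solver as ℚSolver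
import Data.Rational.Unnormalised as ℚᵘ
import Data.Rational.Unnormalised.Properties as ℚᵘ
open import Data.Sum using (_⊎_; inj₁; inj₂; swap)
open import Function using (_⇔_; mk⇔)
open import Function.Definitions using (Injective)
open import Relation.Nullary using (¬_; Dec; yes; no; does; contradiction)
open import Relation.Nullary.Decidable using (_×-dec_; _⊎-dec_; ¬?; does-⇔; dec-false)
open import Relation.Binary.PropositionalEquality

record Graph (n : ℕ) : Set where
  field
    adj     : Fin n → Fin n → Bool
    adj-sym : ∀ i j → adj i j ≡ adj j i
    irrefl  : ∀ i → adj i i ≡ false

open Graph public

K : ∀ n → Graph n
K n = record
  { adj     = λ i j → does (¬? (i Fin.≟ j))
  ; adj-sym = λ i j → does-⇔ (mk⇔ ≢-sym ≢-sym)
                       (¬? (i Fin.≟ j)) (¬? (j Fin.≟ i))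
  ; irrefl  = λ i → dec-false (¬? (i Fin.≟ i)) (λ i≢i → i≢i refl)
  }

-- The cyclic successor relation 0 → 1 → ⋯ → n-1 → 0.
Next : ∀ {n} → Fin n → Fin n → Set
Next {n} i j = suc (toℕ i) ≡ toℕ j ⊎ (suc (toℕ i) ≡ n × toℕ j ≡ 0)

next? : ∀ {n} (i j : Fin n) → Dec (Next i j)
next? {n} i j = (suc (toℕ i) ℕ.≟ toℕ j)
          ⊎-dec ((suc (toℕ i) ℕ.≟ n) ×-dec (toℕ j ℕ.≟ 0))

¬Next-refl : ∀ {n} → 3 ℕ.≤ n → (i : Fin n) → ¬ Next i i
¬Next-refl _   i (inj₁ eq)       = ℕ.1+n≢n eq
¬Next-refl 3≤n i (inj₂ (eq , z)) with trans (sym eq) (cong suc z)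
... | refl = contradiction 3≤n λ { (s≤s ()) }

C : ∀ n → 3 ℕ.≤ n → Graph n
C n 3≤n = record
  { adj     = λ i j → does (next? i j ⊎-dec next? j i)
  ; adj-sym = λ i j → does-⇔ (mk⇔ swap swap)
                       (next? i j ⊎-dec next? j i) (next? j i ⊎-dec next? i j)
  ; irrefl  = λ i → dec-false (next? i i ⊎-dec next? i i)
                     λ { (inj₁ p) → ¬Next-refl 3≤n i p
                       ; (inj₂ p) → ¬Next-refl 3≤n i p }
  }

record Subgraph {n} (G : Graph n) : Set where
  field
    vertices : Subset n
    -- The edges of the subgraph, as a graph on the ambient vertex set.
    edges    : Graph n
    edges⊆G  : ∀ i j → T (adj edges i j) → T (adj G i j)
    incident : ∀ i j → T (adj edges i j) → i ∈ vertices × j ∈ vertices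

open Subgraph public

-- H is isomorphic to the subgraph S: the map is a bijection onto the vertices
-- of S under which adjacency in H is adjacency in S.
record _≅_ {m n} (H : Graph m) {G : Graph n} (S : Subgraph G) : Set where
  field
    to        : Fin m → Fin n
    injective : Injective _≡_ _≡_ to
    image     : ∀ i → i ∈ vertices S ⇔ (∃[ u ] to u ≡ i)
    adj-≡     : ∀ u v → adj H u v ≡ adj (edges S) (to u) (to v)

-- An edge-colouring of a graph on Fin n.  Values at pairs that are not edges
-- of the graph are never used.
record Colouring (n r : ℕ) : Set where
  field
    colour     : Fin n → Fin n → Fin r
    colour-sym : ∀ i j → colour i j ≡ colour j i

open Colouring public

-- Each edge {i , j} is counted once, as the pair with i < j.
edgesOfColour : ∀ {n r} → Graph n → Colouring n r → Fin r → ℕ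
edgesOfColour {n} G c k = length (filter
  (λ (i , j) → (i Fin.<? j) ×-dec (T? (adj G i j) ×-dec (colour c i j Fin.≟ k)))
  (cartesianProduct (allFin n) (allFin n)))

Odd : ℕ → Set
Odd k = ¬ (2 ∣ k)

IsOddColouring : ∀ {m n r} → Graph n → Graph m → Colouring n r → Set
IsOddColouring G H c =
  (S : Subgraph G) → H ≅ S → ∃[ k ] Odd (edgesOfColour (edges S) c k)

OddColourable : ∀ {m n} → Graph n → Graph m → ℕ → Set
OddColourable {n = n} G H r = Σ (Colouring n r) (IsOddColouring G H)

-- r_odd(G , H) = r, the least positive r admitting a suitable colouring.
-- This is a relation, not a function, since r_odd(G , H) need not exist for
-- arbitrary G and H (for example when H has no edges and embeds in G).
record IsOddRamseyNumber {m n} (G : Graph n) (H : Graph m) (r : ℕ) : Set where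
  field
    positive   : 1 ℕ.≤ r
    colourable : OddColourable G H r
    minimal    : ∀ s → 1 ℕ.≤ s → OddColourable G H s → r ℕ.≤ s

private
  /-mono : ∀ a b j k → a ℕ.* suc k ℕ.≤ b ℕ.* suc j →
           + a / suc j ℚ.≤ + b / suc k
  /-mono a b j k le = ℚ.toℚᵘ-cancel-≤ (begin
    ℚ.toℚᵘ (+ a / suc j)  ≃⟨ ℚ.toℚᵘ-fromℚᵘ (ℚᵘ.mkℚᵘ (+ a) j) ⟩
    ℚᵘ.mkℚᵘ (+ a) j       ≤⟨ ℚᵘ.*≤* (subst₂ ℤ._≤_ (ℤ.pos-* a (suc k))
                                (ℤ.pos-* b (suc j)) (ℤ.+≤+ le)) ⟩
    ℚᵘ.mkℚᵘ (+ b) k       ≃⟨ ℚ.toℚᵘ-fromℚᵘ (ℚᵘ.mkℚᵘ (+ b) k) ⟨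
    ℚ.toℚᵘ (+ b / suc k)  ∎)
    where open ℚᵘ.≤-Reasoning

  /-+ : ∀ a b k → + (a ℕ.+ b) / suc k ≡ + a / suc k ℚ.+ + b / suc k
  /-+ a b k = ℚ.toℚᵘ-injective (begin
    ℚ.toℚᵘ (+ (a ℕ.+ b) / suc k)
      ≈⟨ ℚ.toℚᵘ-fromℚᵘ (ℚᵘ.mkℚᵘ (+ (a ℕ.+ b)) k) ⟩
    ℚᵘ.mkℚᵘ (+ (a ℕ.+ b)) k
      ≈⟨ ℚᵘ.*≡* nat ⟩
    ℚᵘ.mkℚᵘ (+ a) k ℚᵘ.+ ℚᵘ.mkℚᵘ (+ b) k
      ≈⟨ ℚᵘ.+-cong (ℚ.toℚᵘ-fromℚᵘ (ℚᵘ.mkℚᵘ (+ a) k))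
                   (ℚ.toℚᵘ-fromℚᵘ (ℚᵘ.mkℚᵘ (+ b) k)) ⟨
    ℚ.toℚᵘ (+ a / suc k) ℚᵘ.+ ℚ.toℚᵘ (+ b / suc k)
      ≈⟨ ℚ.toℚᵘ-homo-+ (+ a / suc k) (+ b / suc k) ⟨
    ℚ.toℚᵘ (+ a / suc k ℚ.+ + b / suc k) ∎)
    where
    open import Relation.Binary.Reasoning.Setoid ℚᵘ.≃-setoid
    K′ = + suc k
    nat : + (a ℕ.+ b) ℤ.* (K′ ℤ.* K′) ≡ (+ a ℤ.* K′ ℤ.+ + b ℤ.* K′) ℤ.* K′
    nat = trans (cong (ℤ._* (K′ ℤ.* K′)) (ℤ.pos-+ a b))
         (trans (sym (ℤ.*-assoc (+ a ℤ.+ + b) K′ K′))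
                (cong (ℤ._* K′) (ℤ.*-distribʳ-+ K′ (+ a) (+ b))))

  /-* : ∀ a b j k → + (a ℕ.* b) / (suc j ℕ.* suc k)
                  ≡ (+ a / suc j) ℚ.* (+ b / suc k)
  /-* a b j k = ℚ.toℚᵘ-injective (begin
    ℚ.toℚᵘ (+ (a ℕ.* b) / (suc j ℕ.* suc k))
      ≈⟨ ℚ.toℚᵘ-fromℚᵘ (ℚᵘ.mkℚᵘ (+ (a ℕ.* b)) (k ℕ.+ j ℕ.* suc k)) ⟩
    ℚᵘ.mkℚᵘ (+ (a ℕ.* b)) (k ℕ.+ j ℕ.* suc k)
      ≈⟨ ℚᵘ.*≡* (cong (ℤ._* (+ (suc j ℕ.* suc k))) (ℤ.pos-* a b)) ⟩
    ℚᵘ.mkℚᵘ (+ a) j ℚᵘ.* ℚᵘ.mkℚᵘ (+ b) k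
      ≈⟨ ℚᵘ.*-cong (ℚ.toℚᵘ-fromℚᵘ (ℚᵘ.mkℚᵘ (+ a) j))
                   (ℚ.toℚᵘ-fromℚᵘ (ℚᵘ.mkℚᵘ (+ b) k)) ⟨
    ℚ.toℚᵘ (+ a / suc j) ℚᵘ.* ℚ.toℚᵘ (+ b / suc k)
      ≈⟨ ℚ.toℚᵘ-homo-* (+ a / suc j) (+ b / suc k) ⟨
    ℚ.toℚᵘ ((+ a / suc j) ℚ.* (+ b / suc k)) ∎)
    where open import Relation.Binary.Reasoning.Setoid ℚᵘ.≃-setoid

  archimedean : ∀ b ε → 0ℚ ℚ.< ε →
                ∃[ N ] ∀ k → N ℕ.≤ k → + b / suc k ℚ.≤ ε
  archimedean b (mkℚ (ℤ.-[1+ _ ]) _ _) (ℚ.*<* ())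
  archimedean b (mkℚ (+ 0) _ _) (ℚ.*<* (ℤ.+<+ ()))
  archimedean b ε@(mkℚ +[1+ p ] d _) 0<ε =
    b ℕ.* suc d , λ k N≤k →
      subst (+ b / suc k ℚ.≤_) (ℚ.↥p/↧p≡p ε)
        (/-mono b (suc p) k d
          (ℕ.≤-trans N≤k (ℕ.≤-trans (ℕ.n≤1+n k) (ℕ.m≤m+n (suc k) (p ℕ.* suc k)))))

  half : ∀ {ε} → 0ℚ ℚ.< ε → 0ℚ ℚ.< ½ ℚ.* ε
  half {ε} 0<ε = subst (ℚ._< ½ ℚ.* ε) (ℚ.*-zeroʳ ½) (ℚ.*-monoʳ-<-pos ½ 0<ε)

  half+half : ∀ ε → ½ ℚ.* ε ℚ.+ ½ ℚ.* ε ≡ ε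
  half+half ε = trans (sym (ℚ.*-distribʳ-+ ε ½ ½)) (ℚ.*-identityˡ ε)

  +-pos : ∀ {p q} → 0ℚ ℚ.< p → 0ℚ ℚ.< q → 0ℚ ℚ.< p ℚ.+ q
  +-pos {p} {q} 0<p 0<q =
    subst (ℚ._< p ℚ.+ q) (ℚ.+-identityʳ 0ℚ) (ℚ.+-mono-< 0<p 0<q)

  divide : ∀ D ε → 0ℚ ℚ.< D → 0ℚ ℚ.< ε → ∃[ e ] 0ℚ ℚ.< e × D ℚ.* e ≡ ε
  divide D ε 0<D 0<ε = (1/ D) ℚ.* ε ,
    subst (ℚ._< (1/ D) ℚ.* ε) (ℚ.*-zeroʳ (1/ D))
      (ℚ.*-monoʳ-<-pos (1/ D) {{ℚ.1/pos⇒pos D}} 0<ε) ,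
    trans (sym (ℚ.*-assoc D (1/ D) ε))
      (trans (cong (ℚ._* ε) (ℚ.*-inverseʳ D)) (ℚ.*-identityˡ ε))
    where
    instance
      D-pos : ℚ.Positive D
      D-pos = ℚ.positive 0<D
      D-nz : ℚ.NonZero D
      D-nz = ℚ.pos⇒nonZero D

  ∣-∣-comm : ∀ p q → ℚ.∣ p ℚ.- q ∣ ≡ ℚ.∣ q ℚ.- p ∣
  ∣-∣-comm p q = trans (sym (ℚ.∣-p∣≡∣p∣ (p ℚ.- q)))
    (cong ℚ.∣_∣ (solve 2 (λ p q → :- (p :- q) := q :- p) refl p q))
    where open ℚSolver.+-*-Solver

  ∣∣-≤ : ∀ {p e} → p ℚ.≤ e → ℚ.- p ℚ.≤ e → ℚ.∣ p ∣ ℚ.≤ e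
  ∣∣-≤ {p} {e} h₁ h₂ with ℚ.∣p∣≡p∨∣p∣≡-p p
  ... | inj₁ eq = subst (ℚ._≤ e) (sym eq) h₁
  ... | inj₂ eq = subst (ℚ._≤ e) (sym eq) h₂

  ≤+⇒-≤ : ∀ {p q e} → p ℚ.≤ q ℚ.+ e → p ℚ.- q ℚ.≤ e
  ≤+⇒-≤ {p} {q} {e} h = subst (p ℚ.- q ℚ.≤_)
    (solve 2 (λ q e → (q :+ e) :- q := e) refl q e)
    (ℚ.+-monoˡ-≤ (ℚ.- q) h)
    where open ℚSolver.+-*-Solver

  ∣-∣-≤ : ∀ {p q e} → p ℚ.≤ q ℚ.+ e → q ℚ.≤ p ℚ.+ e → ℚ.∣ p ℚ.- q ∣ ℚ.≤ e
  ∣-∣-≤ {p} {q} {e} h₁ h₂ = ∣∣-≤ (≤+⇒-≤ h₁)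
    (subst (ℚ._≤ e) (solve 2 (λ p q → q :- p := :- (p :- q)) refl p q)
      (≤+⇒-≤ h₂))
    where open ℚSolver.+-*-Solver

  ∣∣p∣-∣q∣∣≤ : ∀ p q → ℚ.∣ ℚ.∣ p ∣ ℚ.- ℚ.∣ q ∣ ∣ ℚ.≤ ℚ.∣ p ℚ.- q ∣
  ∣∣p∣-∣q∣∣≤ p q = ∣-∣-≤ (tri p q)
    (subst (λ z → ℚ.∣ q ∣ ℚ.≤ ℚ.∣ p ∣ ℚ.+ z) (∣-∣-comm q p) (tri q p))
    where
    open ℚSolver.+-*-Solver
    tri : ∀ p q → ℚ.∣ p ∣ ℚ.≤ ℚ.∣ q ∣ ℚ.+ ℚ.∣ p ℚ.- q ∣
    tri p q = subst (λ z → ℚ.∣ z ∣ ℚ.≤ ℚ.∣ q ∣ ℚ.+ ℚ.∣ p ℚ.- q ∣)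
      (solve 2 (λ p q → q :+ (p :- q) := p) refl p q)
      (ℚ.∣p+q∣≤∣p∣+∣q∣ q (p ℚ.- q))

-- Reals are Cauchy sequences of rationals; equality is _≃_, not _≡_.
record ℝ : Set where
  field
    seq    : ℕ → ℚ
    cauchy : ∀ ε → 0ℚ ℚ.< ε → ∃[ N ] ∀ m n → N ℕ.≤ m → N ℕ.≤ n →
             ℚ.∣ seq m ℚ.- seq n ∣ ℚ.≤ ε

open ℝ public

infix  4 _≤_ _<_ _≃_
infixl 6 _+_
infixl 7 _*_

-- An ε of slack is needed: the terms of equal reals may approach from
-- either side.
_≤_ : ℝ → ℝ → Set
x ≤ y = ∀ ε → 0ℚ ℚ.< ε → ∃[ N ] ∀ n → N ℕ.≤ n → seq x n ℚ.≤ seq y n ℚ.+ ε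

_<_ : ℝ → ℝ → Set
x < y = ∃[ ε ] 0ℚ ℚ.< ε × (∃[ N ] ∀ n → N ℕ.≤ n → seq x n ℚ.+ ε ℚ.≤ seq y n)

_≃_ : ℝ → ℝ → Set
x ≃ y = x ≤ y × y ≤ x

fromℚ : ℚ → ℝ
fromℚ q = record
  { seq    = λ _ → q
  ; cauchy = λ ε 0<ε → 0 , λ _ _ _ _ →
      subst (λ z → ℚ.∣ z ∣ ℚ.≤ ε) (sym (ℚ.+-inverseʳ q)) (ℚ.<⇒≤ 0<ε)
  }

fromℕ : ℕ → ℝ
fromℕ n = fromℚ (+ n / 1)

0ℝ : ℝ
0ℝ = fromℕ 0

∣_∣ : ℝ → ℝ
∣ x ∣ = record
  { seq    = λ n → ℚ.∣ seq x n ∣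
  ; cauchy = λ ε 0<ε → let (N , h) = cauchy x ε 0<ε in
      N , λ m n N≤m N≤n →
        ℚ.≤-trans (∣∣p∣-∣q∣∣≤ (seq x m) (seq x n)) (h m n N≤m N≤n)
  }

_+_ : ℝ → ℝ → ℝ
x + y = record
  { seq    = λ n → seq x n ℚ.+ seq y n
  ; cauchy = λ ε 0<ε →
      let (M , hx) = cauchy x (½ ℚ.* ε) (half 0<ε)
          (N , hy) = cauchy y (½ ℚ.* ε) (half 0<ε)
      in M ℕ.⊔ N , λ m n l l′ →
        subst (_ ℚ.≤_) (half+half ε)
          (ℚ.≤-trans
            (bound (seq x m) (seq x n) (seq y m) (seq y n))
            (ℚ.+-mono-≤
              (hx m n (ℕ.m⊔n≤o⇒m≤o M N l) (ℕ.m⊔n≤o⇒m≤o M N l′))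
              (hy m n (ℕ.m⊔n≤o⇒n≤o M N l) (ℕ.m⊔n≤o⇒n≤o M N l′))))
  }
  where
  open ℚSolver.+-*-Solver
  bound : ∀ a b c d → ℚ.∣ (a ℚ.+ c) ℚ.- (b ℚ.+ d) ∣ ℚ.≤
                      ℚ.∣ a ℚ.- b ∣ ℚ.+ ℚ.∣ c ℚ.- d ∣
  bound a b c d = subst (λ z → ℚ.∣ z ∣ ℚ.≤ ℚ.∣ a ℚ.- b ∣ ℚ.+ ℚ.∣ c ℚ.- d ∣)
    (solve 4 (λ a b c d → (a :- b) :+ (c :- d) := (a :+ c) :- (b :+ d))
      refl a b c d)
    (ℚ.∣p+q∣≤∣p∣+∣q∣ (a ℚ.- b) (c ℚ.- d))

private
  eventuallyBounded : ∀ x → ∃[ B ] 0ℚ ℚ.< B ×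
    (∃[ N ] ∀ n → N ℕ.≤ n → ℚ.∣ seq x n ∣ ℚ.≤ B)
  eventuallyBounded x =
    let (N , h) = cauchy x 1ℚ (ℚ.positive⁻¹ 1ℚ)
        a = seq x N
    in 1ℚ ℚ.+ ℚ.∣ a ∣ ,
       ℚ.<-≤-trans (ℚ.positive⁻¹ 1ℚ)
         (subst (ℚ._≤ 1ℚ ℚ.+ ℚ.∣ a ∣) (ℚ.+-identityʳ 1ℚ)
           (ℚ.+-monoʳ-≤ 1ℚ (ℚ.0≤∣p∣ a))) ,
       N , λ n N≤n →
         subst (λ z → ℚ.∣ z ∣ ℚ.≤ 1ℚ ℚ.+ ℚ.∣ a ∣)
           (solve 2 (λ a b → (b :- a) :+ a := b) refl a (seq x n))
           (ℚ.≤-trans (ℚ.∣p+q∣≤∣p∣+∣q∣ (seq x n ℚ.- a) a)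
             (ℚ.+-monoˡ-≤ ℚ.∣ a ∣ (h n N N≤n ℕ.≤-refl)))
    where open ℚSolver.+-*-Solver

  *-bound : ∀ {A B e} a b c d → 0ℚ ℚ.< A → 0ℚ ℚ.< e →
    ℚ.∣ a ∣ ℚ.≤ A → ℚ.∣ d ∣ ℚ.≤ B →
    ℚ.∣ a ℚ.- b ∣ ℚ.≤ e → ℚ.∣ c ℚ.- d ∣ ℚ.≤ e →
    ℚ.∣ a ℚ.* c ℚ.- b ℚ.* d ∣ ℚ.≤ (A ℚ.+ B) ℚ.* e
  *-bound {A} {B} {e} a b c d 0<A 0<e ∣a∣≤A ∣d∣≤B hab hcd = begin
    ℚ.∣ a ℚ.* c ℚ.- b ℚ.* d ∣
      ≡⟨ cong ℚ.∣_∣ (solve 4 (λ a b c d →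
           a :* c :- b :* d := a :* (c :- d) :+ d :* (a :- b)) refl a b c d) ⟩
    ℚ.∣ a ℚ.* (c ℚ.- d) ℚ.+ d ℚ.* (a ℚ.- b) ∣
      ≤⟨ ℚ.∣p+q∣≤∣p∣+∣q∣ (a ℚ.* (c ℚ.- d)) (d ℚ.* (a ℚ.- b)) ⟩
    ℚ.∣ a ℚ.* (c ℚ.- d) ∣ ℚ.+ ℚ.∣ d ℚ.* (a ℚ.- b) ∣
      ≡⟨ cong₂ ℚ._+_ (ℚ.∣p*q∣≡∣p∣*∣q∣ a (c ℚ.- d)) (ℚ.∣p*q∣≡∣p∣*∣q∣ d (a ℚ.- b)) ⟩
    ℚ.∣ a ∣ ℚ.* ℚ.∣ c ℚ.- d ∣ ℚ.+ ℚ.∣ d ∣ ℚ.* ℚ.∣ a ℚ.- b ∣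
      ≤⟨ ℚ.+-mono-≤ (mul a (c ℚ.- d) ∣a∣≤A hcd) (mul d (a ℚ.- b) ∣d∣≤B hab) ⟩
    A ℚ.* e ℚ.+ B ℚ.* e
      ≡⟨ ℚ.*-distribʳ-+ e A B ⟨
    (A ℚ.+ B) ℚ.* e ∎
    where
    open ℚSolver.+-*-Solver
    open ℚ.≤-Reasoning
    mul : ∀ {D} p q → ℚ.∣ p ∣ ℚ.≤ D → ℚ.∣ q ∣ ℚ.≤ e →
          ℚ.∣ p ∣ ℚ.* ℚ.∣ q ∣ ℚ.≤ D ℚ.* e
    mul {D} p q h k =
      ℚ.≤-trans
        (ℚ.*-monoˡ-≤-nonNeg ℚ.∣ p ∣ {{ℚ.∣-∣-nonNeg p}} k)
        (ℚ.*-monoʳ-≤-nonNeg e {{ℚ.nonNegative (ℚ.<⇒≤ 0<e)}} h)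

_*_ : ℝ → ℝ → ℝ
x * y = record
  { seq    = λ n → seq x n ℚ.* seq y n
  ; cauchy = λ ε 0<ε →
      let (A , 0<A , N₁ , hA) = eventuallyBounded x
          (B , 0<B , N₂ , hB) = eventuallyBounded y
          (e , 0<e , De≡ε)    = divide (A ℚ.+ B) ε (+-pos 0<A 0<B) 0<ε
          (N₃ , hx)           = cauchy x e 0<e
          (N₄ , hy)           = cauchy y e 0<e
      in (N₁ ℕ.⊔ N₂) ℕ.⊔ (N₃ ℕ.⊔ N₄) , λ m n l l′ →
        let (l₁ , _ , l₃ , l₄)      = split N₁ N₂ N₃ N₄ l
            (_ , l₂′ , l₃′ , l₄′) = split N₁ N₂ N₃ N₄ l′
        in subst (ℚ.∣ seq x m ℚ.* seq y m ℚ.- seq x n ℚ.* seq y n ∣ ℚ.≤_) De≡ε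
             (*-bound (seq x m) (seq x n) (seq y m) (seq y n) 0<A 0<e
               (hA m l₁) (hB n l₂′) (hx m n l₃ l₃′) (hy m n l₄ l₄′))
  }
  where
  split : ∀ a b c d {m} → (a ℕ.⊔ b) ℕ.⊔ (c ℕ.⊔ d) ℕ.≤ m →
          a ℕ.≤ m × b ℕ.≤ m × c ℕ.≤ m × d ℕ.≤ m
  split a b c d l =
    let l₁ = ℕ.m⊔n≤o⇒m≤o (a ℕ.⊔ b) (c ℕ.⊔ d) l
        l₂ = ℕ.m⊔n≤o⇒n≤o (a ℕ.⊔ b) (c ℕ.⊔ d) l
    in ℕ.m⊔n≤o⇒m≤o a b l₁ , ℕ.m⊔n≤o⇒n≤o a b l₁ ,
       ℕ.m⊔n≤o⇒m≤o c d l₂ , ℕ.m⊔n≤o⇒n≤o c d l₂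

-- ⌊√ m ⌋
isqrt : ℕ → ℕ
isqrt zero = 0
isqrt (suc m) with suc (isqrt m) ℕ.* suc (isqrt m) ℕ.≤? suc m
... | yes _ = suc (isqrt m)
... | no  _ = isqrt m

isqrt-lower : ∀ m → isqrt m ℕ.* isqrt m ℕ.≤ m
isqrt-lower zero = z≤n
isqrt-lower (suc m) with suc (isqrt m) ℕ.* suc (isqrt m) ℕ.≤? suc m
... | yes h = h
... | no  _ = ℕ.≤-trans (isqrt-lower m) (ℕ.n≤1+n m)

isqrt-upper : ∀ m → m ℕ.< suc (isqrt m) ℕ.* suc (isqrt m)
isqrt-upper zero = s≤s z≤n
isqrt-upper (suc m) with suc (isqrt m) ℕ.* suc (isqrt m) ℕ.≤? suc m
... | yes _ = ℕ.≤-<-trans (isqrt-upper m)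
                (ℕ.*-mono-< (ℕ.n<1+n (suc (isqrt m))) (ℕ.n<1+n (suc (isqrt m))))
... | no  h = ℕ.≰⇒> h

private
  square-cancel-< : ∀ a b → a ℕ.* a ℕ.< b ℕ.* b → a ℕ.< b
  square-cancel-< a b h with b ℕ.≤? a
  ... | yes b≤a = contradiction (ℕ.*-mono-≤ b≤a b≤a) (ℕ.<⇒≱ h)
  ... | no  b≰a = ℕ.≰⇒> b≰a

-- The approximations ⌊(k+1)√n⌋ / (k+1) to √n.
√seq : ℕ → ℕ → ℚ
√seq n k = + isqrt (n ℕ.* (suc k ℕ.* suc k)) / suc k

private
  √seq-close : ∀ n j k → √seq n j ℚ.≤ √seq n k ℚ.+ + 1 / suc k
  √seq-close n j k = subst (√seq n j ℚ.≤_)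
    (trans (cong (λ z → + z / suc k) (ℕ.+-comm 1 b)) (/-+ b 1 k))
    (/-mono a (suc b) j k (ℕ.<⇒≤ (square-cancel-< (a ℕ.* suc k) (suc b ℕ.* suc j)
      (begin-strict
        (a ℕ.* suc k) ℕ.* (a ℕ.* suc k)
          ≡⟨ solve 2 (λ a k → (a :* k) :* (a :* k) := (a :* a) :* (k :* k)) refl a (suc k) ⟩
        (a ℕ.* a) ℕ.* (suc k ℕ.* suc k)
          ≤⟨ ℕ.*-monoˡ-≤ (suc k ℕ.* suc k) (isqrt-lower (n ℕ.* (suc j ℕ.* suc j))) ⟩
        (n ℕ.* (suc j ℕ.* suc j)) ℕ.* (suc k ℕ.* suc k)
          ≡⟨ solve 3 (λ n j k → (n :* (j :* j)) :* (k :* k) := (n :* (k :* k)) :* (j :* j)) refl n (suc j) (suc k) ⟩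
        (n ℕ.* (suc k ℕ.* suc k)) ℕ.* (suc j ℕ.* suc j)
          <⟨ ℕ.*-monoˡ-< (suc j ℕ.* suc j) (isqrt-upper (n ℕ.* (suc k ℕ.* suc k))) ⟩
        (suc b ℕ.* suc b) ℕ.* (suc j ℕ.* suc j)
          ≡⟨ solve 2 (λ b j → (b :* b) :* (j :* j) := (b :* j) :* (b :* j)) refl (suc b) (suc j) ⟩
        (suc b ℕ.* suc j) ℕ.* (suc b ℕ.* suc j) ∎))))
    where
    open ℕ.≤-Reasoning
    open +-*-Solver
    a = isqrt (n ℕ.* (suc j ℕ.* suc j))
    b = isqrt (n ℕ.* (suc k ℕ.* suc k))

√ : ℕ → ℝ
√ n = record
  { seq    = √seq n
  ; cauchy = λ ε 0<ε → let (N , h) = archimedean 1 ε 0<ε in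
      N , λ j k N≤j N≤k → ∣-∣-≤ {√seq n j} {√seq n k} {ε}
        (ℚ.≤-trans (√seq-close n j k) (ℚ.+-monoʳ-≤ (√seq n k) (h k N≤k)))
        (ℚ.≤-trans (√seq-close n k j) (ℚ.+-monoʳ-≤ (√seq n j) (h j N≤j)))
  }

√-nonNegative : ∀ n → 0ℝ ≤ √ n
√-nonNegative n ε 0<ε = 0 , λ k _ →
  ℚ.≤-trans (/-mono 0 (isqrt (n ℕ.* (suc k ℕ.* suc k))) 0 k z≤n)
    (subst (ℚ._≤ √seq n k ℚ.+ ε) (ℚ.+-identityʳ (√seq n k))
      (ℚ.+-monoʳ-≤ (√seq n k) (ℚ.<⇒≤ 0<ε)))

√-square : ∀ n → √ n * √ n ≃ fromℕ n
√-square n = upper , lower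
  where
  open +-*-Solver
  a : ℕ → ℕ
  a k = isqrt (n ℕ.* (suc k ℕ.* suc k))

  upper : √ n * √ n ≤ fromℕ n
  upper ε 0<ε = 0 , λ k _ → ℚ.≤-trans
    (subst (ℚ._≤ + n / 1) (/-* (a k) (a k) k k)
      (/-mono (a k ℕ.* a k) n (k ℕ.+ k ℕ.* suc k) 0
        (subst (ℕ._≤ n ℕ.* (suc k ℕ.* suc k)) (sym (ℕ.*-identityʳ (a k ℕ.* a k)))
          (isqrt-lower (n ℕ.* (suc k ℕ.* suc k))))))
    (subst (ℚ._≤ + n / 1 ℚ.+ ε) (ℚ.+-identityʳ (+ n / 1))
      (ℚ.+-monoʳ-≤ (+ n / 1) (ℚ.<⇒≤ 0<ε)))

  a≤ : ∀ k → a k ℕ.≤ n ℕ.* suc k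
  a≤ k = ℕ.≤-pred (square-cancel-< (a k) (suc (n ℕ.* suc k)) (begin-strict
    a k ℕ.* a k                         ≤⟨ isqrt-lower (n ℕ.* (suc k ℕ.* suc k)) ⟩
    n ℕ.* (suc k ℕ.* suc k)             ≤⟨ n≤n² n (suc k) ⟩
    (n ℕ.* suc k) ℕ.* (n ℕ.* suc k)     <⟨ ℕ.*-mono-< (ℕ.n<1+n (n ℕ.* suc k)) (ℕ.n<1+n (n ℕ.* suc k)) ⟩
    suc (n ℕ.* suc k) ℕ.* suc (n ℕ.* suc k) ∎))
    where
    open ℕ.≤-Reasoning
    n≤n² : ∀ n m → n ℕ.* (m ℕ.* m) ℕ.≤ (n ℕ.* m) ℕ.* (n ℕ.* m)
    n≤n² zero    m = z≤n
    n≤n² (suc n) m = subst (suc n ℕ.* (m ℕ.* m) ℕ.≤_)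
      (solve 2 (λ n m → (n :* (m :* m)) :* n := (n :* m) :* (n :* m)) refl (suc n) m)
      (ℕ.m≤m*n (suc n ℕ.* (m ℕ.* m)) (suc n))

  key : ∀ k → n ℕ.* (suc k ℕ.* suc k) ℕ.≤ a k ℕ.* a k ℕ.+ (2 ℕ.* n ℕ.+ 1) ℕ.* suc k
  key k = begin
    n ℕ.* (suc k ℕ.* suc k)
      ≤⟨ ℕ.≤-trans (ℕ.n≤1+n _) (isqrt-upper (n ℕ.* (suc k ℕ.* suc k))) ⟩
    suc (a k) ℕ.* suc (a k)
      ≡⟨ solve 1 (λ a → (con 1 :+ a) :* (con 1 :+ a) := a :* a :+ (con 2 :* a :+ con 1)) refl (a k) ⟩
    a k ℕ.* a k ℕ.+ (2 ℕ.* a k ℕ.+ 1)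
      ≤⟨ ℕ.+-monoʳ-≤ (a k ℕ.* a k)
           (ℕ.+-mono-≤ (ℕ.*-monoʳ-≤ 2 (a≤ k)) (s≤s z≤n)) ⟩
    a k ℕ.* a k ℕ.+ (2 ℕ.* (n ℕ.* suc k) ℕ.+ suc k)
      ≡⟨ solve 3 (λ s n k → s :+ (con 2 :* (n :* k) :+ k) := s :+ (con 2 :* n :+ con 1) :* k)
           refl (a k ℕ.* a k) n (suc k) ⟩
    a k ℕ.* a k ℕ.+ (2 ℕ.* n ℕ.+ 1) ℕ.* suc k ∎
    where open ℕ.≤-Reasoning

  lower : fromℕ n ≤ √ n * √ n
  lower ε 0<ε = let (N , h) = archimedean (2 ℕ.* n ℕ.+ 1) ε 0<ε in
    N , λ k N≤k → begin
      + n / 1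
        ≤⟨ /-mono n (a k ℕ.* a k ℕ.+ (2 ℕ.* n ℕ.+ 1) ℕ.* suc k) 0 (k ℕ.+ k ℕ.* suc k)
             (subst (n ℕ.* (suc k ℕ.* suc k) ℕ.≤_) (sym (ℕ.*-identityʳ _)) (key k)) ⟩
      + (a k ℕ.* a k ℕ.+ (2 ℕ.* n ℕ.+ 1) ℕ.* suc k) / (suc k ℕ.* suc k)
        ≡⟨ /-+ (a k ℕ.* a k) ((2 ℕ.* n ℕ.+ 1) ℕ.* suc k) (k ℕ.+ k ℕ.* suc k) ⟩
      + (a k ℕ.* a k) / (suc k ℕ.* suc k) ℚ.+ + ((2 ℕ.* n ℕ.+ 1) ℕ.* suc k) / (suc k ℕ.* suc k)
        ≤⟨ ℚ.+-mono-≤ (ℚ.≤-reflexive (/-* (a k) (a k) k k))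
             (/-mono ((2 ℕ.* n ℕ.+ 1) ℕ.* suc k) (2 ℕ.* n ℕ.+ 1) (k ℕ.+ k ℕ.* suc k) k
               (ℕ.≤-reflexive (ℕ.*-assoc (2 ℕ.* n ℕ.+ 1) (suc k) (suc k)))) ⟩
      √seq n k ℚ.* √seq n k ℚ.+ + (2 ℕ.* n ℕ.+ 1) / suc k
        ≤⟨ ℚ.+-monoʳ-≤ (√seq n k ℚ.* √seq n k) (h k N≤k) ⟩
      √seq n k ℚ.* √seq n k ℚ.+ ε ∎
    where open ℚ.≤-Reasoning

-- Both proofs are unique, so functions on Even≥4 are functions of the value.
record Even≥4 : Set where
  field
    value : ℕ
    even  : 2 ∣ value
    4≤    : 4 ℕ.≤ value

  3≤ : 3 ℕ.≤ value
  3≤ = ℕ.≤-trans (ℕ.n≤1+n 3) 4≤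

open Even≥4 public

TendsToZero : (Even≥4 → ℝ) → Set
TendsToZero f =
  ∀ δ → 0ℝ < δ → ∃[ N ] ∀ n → N ℕ.≤ value n → ∣ f n ∣ < δ

-- Upper bound.  Let k = 2ᵇ satisfy k² ≤ 2(n − 2) < 4k².  One vertex is the hub;
-- every other vertex gets its own label (g , h) with g in a group F₂ᵇ of order k
-- and h ∈ {0 , … , j}.  An edge away from the hub is coloured g + g′, a hub edge
-- by h (by the colour 0 of the group if h = 0).  If all colours are even on a
-- Hamilton cycle, the two neighbours of the hub have the same label.
--
-- Lower bound.  Map each edge to the unit vector of its colour in F₂ʳ.  A gadget
-- a b c d can be traversed as abcd or acbd, which changes the sum along the cycle
-- by a 4-cycle sum.  An augmenting argument in the style of Haxell's theorem
-- gives disjoint gadgets and a set D of at most 8r vertices, disjoint from them,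
-- such that the sums of the chosen gadgets span the sums of all gadgets avoiding D.
-- Modulo this span the edges outside D are of the form g u + g v + κ.  When
-- n > r² + O(r), each y ∈ D can be put between two vertices w, w′ which have the
-- same colour to y and the same g; then the sum along the whole cycle lies in the
-- span, and re-routing some gadgets makes it zero.
--
-- So r ≥ √(n/2) for n ≥ 1200, and ε need only be non-zero for smaller n.
module Submission where

open import Data.Bool using (Bool; true; false; _∧_; _∨_; _xor_; not; T; if_then_else_)
import Data.Bool.Properties as Bool
open import Data.Bool.Solver using (module xor-∧-Solver)
open import Data.Fin as Fin using (Fin; zero; suc; toℕ; _↑ˡ_; _↑ʳ_)
open import Data.Fin.Permutation using (Permutation′; permutation; _⟨$⟩ˡ_; inverseʳ; inverseˡ)
import Data.Fin.Properties as Fin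
import Data.Fin.Subset as Subset
import Data.Fin.Subset.Properties as Subset
import Data.Integer as ℤ
open import Data.Integer using (+[1+_])
import Data.Integer.Properties as ℤ
open import Data.List using (List; []; _∷_; _++_; length; map; concatMap; filter;
  deduplicate; tabulate; allFin; lookup; cartesianProduct)
open import Data.List.Membership.DecPropositional using (_∈?_)
open import Data.List.Membership.Propositional using (_∈_; _∉_)
open import Data.List.Membership.Propositional.Properties
open import Data.List.Membership.Propositional.Properties.WithK using (unique∧set⇒bag)
import Data.List.Properties as List
open import Data.List.Relation.Binary.BagAndSetEquality using (∼bag⇒↭)
open import Data.List.Relation.Binary.Disjoint.DecPropositional using (disjoint?)
open import Data.List.Relation.Binary.Permutation.Propositional
  using (_↭_; ↭-refl; ↭-sym; ↭-trans; prep; swap; ↭-reflexive; ↭⇒↭ₛ; module PermutationReasoning)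
open import Data.List.Relation.Binary.Permutation.Propositional.Properties
  using (All-resp-↭; ∈-resp-↭; ↭-length; shift; shifts; ++⁺ʳ; ++⁺ˡ; ++-comm)
import Data.List.Relation.Binary.Permutation.Setoid.Properties as PermutationS
open import Data.List.Relation.Unary.All as All using (All; []; _∷_)
import Data.List.Relation.Unary.All.Properties as All
open import Data.List.Relation.Unary.AllPairs as AllPairs using (AllPairs; []; _∷_)
import Data.List.Relation.Unary.AllPairs.Properties as AllPairs
open import Data.List.Relation.Unary.Any using (here; there)
open import Data.List.Relation.Unary.Unique.DecPropositional using (unique?)
open import Data.List.Relation.Unary.Unique.DecPropositional.Properties using (deduplicate-!)
open import Data.List.Relation.Unary.Unique.Propositional using (Unique)
import Data.List.Relation.Unary.Unique.Propositional.Properties as Unique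
open import Data.Nat as ℕ using (ℕ; zero; suc; s≤s; z≤n)
open import Data.Nat.Divisibility using (_∣_; _∣?_; divides; ∣m+n∣m⇒∣n; n∣m*n)
import Data.Nat.Properties as ℕ
open import Data.Nat.Solver using (module +-*-Solver)
open import Data.Product using (Σ; ∃; ∃-syntax; _×_; _,_; proj₁; proj₂)
open import Data.Rational as ℚ using (ℚ; mkℚ; 0ℚ)
import Data.Rational.Properties as ℚ
import Data.Rational.Unnormalised as ℚᵘ
import Data.Rational.Unnormalised.Properties as ℚᵘ
open import Data.Sum using (_⊎_; inj₁; inj₂; [_,_])
open import Data.Vec as Vec using (Vec; []; _∷_; zipWith; replicate)
import Data.Vec.Properties as Vec
open import Function using (_∘_; id; const; mk⇔)
open import Function.Definitions using (Injective)
open import Relation.Binary.PropositionalEquality hiding ([_])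
import Relation.Binary.Reasoning.Setoid as SetoidReasoning
open import Relation.Nullary using (¬_; Dec; yes; no; does; contradiction)
open import Relation.Nullary.Decidable using (map′; _×-dec_; _⊎-dec_; _→-dec_; ¬?; dec-true; dec-false; decidable-stable)
open import Relation.Unary using (Decidable)

open import Algebra.Properties.CommutativeMonoid.Sum ℕ.+-0-commutativeMonoid
  using (sum; sum-cong-≗; ∑-distrib-+; ∑-comm; sum-permute; sum-remove; sum-replicate-zero)

-- A maximal disjoint family of gadgets with independent sums would not do: a gadget through one of
-- its vertices may leave the span, and these vertices cannot be deleted, because the family itself
-- is needed for the final correction. So the deleted set and the family must be disjoint, and an
-- exchange argument has to either enlarge the span or give up some gadgets for good.
--
-- Evenness of n enters through κ: along the cycle every g occurs twice and cancels, while κ occurs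
-- once for each vertex or inserted triple after the first two vertices, an even number of times.
--
-- The term r² comes from a pigeonhole on pairs of colours, so the argument in fact gives r ≥ (1 -
-- o(1))√n. As √2/2 < 1, there is room to absorb the linear term from a definite n on; this is why ε
-- can be 0 there.
--
-- In the upper bound k must be a power of 2, being the order of F₂ᵇ. So k/j can only be confined to
-- [1/2, 2]. On this range (k + j)² / (k j) is at most 9/2, whose root is 3√2/2.

module Combinatorics where

  open import Defs hiding (_≤_; _<_; _+_; _*_; ∣_∣)
  open import Data.Nat using (_+_; _*_; _^_; _≤_; _<_)
  open import Data.Nat.DivMod using (_/_; m/n*n≤m; m≡m%n+[m/n]*n; m%n<n)

  -- Vectors and spans over F₂

  private module B = xor-∧-Solver

  infixl 6 _⊕_

  _⊕_ : ∀ {r} → Vec Bool r → Vec Bool r → Vec Bool r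
  _⊕_ = zipWith _xor_

  0v : ∀ {r} → Vec Bool r
  0v = replicate _ false

  ⊕-identityˡ : ∀ {r} (x : Vec Bool r) → 0v ⊕ x ≡ x
  ⊕-identityˡ []      = refl
  ⊕-identityˡ (a ∷ x) = cong (a ∷_) (⊕-identityˡ x)

  ⊕-same : ∀ {r} (x : Vec Bool r) → x ⊕ x ≡ 0v
  ⊕-same []      = refl
  ⊕-same (a ∷ x) = cong₂ _∷_ (Bool.xor-same a) (⊕-same x)

  ⊕-comm : ∀ {r} (x y : Vec Bool r) → x ⊕ y ≡ y ⊕ x
  ⊕-comm []      []      = refl
  ⊕-comm (a ∷ x) (b ∷ y) = cong₂ _∷_ (B.solve 2 (λ a b → a B.:+ b B.:= b B.:+ a) refl a b) (⊕-comm x y)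

  ⊕-identityʳ : ∀ {r} (x : Vec Bool r) → x ⊕ 0v ≡ x
  ⊕-identityʳ x = trans (⊕-comm x 0v) (⊕-identityˡ x)

  ⊕-assoc : ∀ {r} (x y z : Vec Bool r) → (x ⊕ y) ⊕ z ≡ x ⊕ (y ⊕ z)
  ⊕-assoc []      []      []      = refl
  ⊕-assoc (a ∷ x) (b ∷ y) (c ∷ z) = cong₂ _∷_
    (B.solve 3 (λ a b c → (a B.:+ b) B.:+ c B.:= a B.:+ (b B.:+ c)) refl a b c) (⊕-assoc x y z)

  ⊕-cancel : ∀ {r} (x y : Vec Bool r) → x ⊕ (x ⊕ y) ≡ y
  ⊕-cancel x y = trans (sym (⊕-assoc x x y)) (trans (cong (_⊕ y) (⊕-same x)) (⊕-identityˡ y))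

  _≟v_ : ∀ {r} (x y : Vec Bool r) → Dec (x ≡ y)
  _≟v_ = Vec.≡-dec Bool._≟_

  funToFin-cong : ∀ {m n} {f g : Fin m → Fin n} → f ≗ g → Fin.funToFin f ≡ Fin.funToFin g
  funToFin-cong {zero}  h = refl
  funToFin-cong {suc m} h = cong₂ Fin.combine (h zero) (funToFin-cong (h ∘ suc))

  module Spans {r : ℕ} {Γ : Set} (q : Γ → Vec Bool r) where

    -- Membership is a yes-or-no choice for each entry of the list. `toggle` reads these choices off
    -- as the routes of the gadgets.
    Span : List Γ → Vec Bool r → Set
    Span []      x = x ≡ 0v
    Span (e ∷ F) x = Span F x ⊎ Span F (q e ⊕ x)

    span? : ∀ F x → Dec (Span F x)
    span? []      x = x ≟v 0v
    span? (e ∷ F) x = span? F x ⊎-dec span? F (q e ⊕ x)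

    span-0 : ∀ F → Span F 0v
    span-0 []      = refl
    span-0 (e ∷ F) = inj₁ (span-0 F)

    span-⊕ : ∀ F {x y} → Span F x → Span F y → Span F (x ⊕ y)
    span-⊕ []      refl refl = ⊕-same 0v
    span-⊕ (e ∷ F) (inj₁ p) (inj₁ p′) = inj₁ (span-⊕ F p p′)
    span-⊕ (e ∷ F) {x} {y} (inj₂ p) (inj₁ p′) =
      inj₂ (subst (Span F) (⊕-assoc (q e) x y) (span-⊕ F p p′))
    span-⊕ (e ∷ F) {x} {y} (inj₁ p) (inj₂ p′) =
      inj₂ (subst (Span F) (trans (sym (⊕-assoc x (q e) y))
        (trans (cong (_⊕ y) (⊕-comm x (q e))) (⊕-assoc (q e) x y))) (span-⊕ F p p′))
    span-⊕ (e ∷ F) {x} {y} (inj₂ p) (inj₂ p′) =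
      inj₁ (subst (Span F) (trans (cong (_⊕ (q e ⊕ y)) (⊕-comm (q e) x))
        (trans (⊕-assoc x (q e) (q e ⊕ y)) (cong (x ⊕_) (⊕-cancel (q e) y)))) (span-⊕ F p p′))

    span-∈ : ∀ {F e} → e ∈ F → Span F (q e)
    span-∈ {e ∷ F} (here refl) = inj₂ (subst (Span F) (sym (⊕-same (q e))) (span-0 F))
    span-∈ {e ∷ F} (there i)   = inj₁ (span-∈ i)

    span-mono : ∀ F {F′} → (∀ {e} → e ∈ F → Span F′ (q e)) → ∀ {x} → Span F x → Span F′ x
    span-mono []      h {x} refl     = span-0 _
    span-mono (e ∷ F) h     (inj₁ p) = span-mono F (h ∘ there) p
    span-mono (e ∷ F) {F′} h {x} (inj₂ p) =
      subst (Span F′) (⊕-cancel (q e) x) (span-⊕ F′ (h (here refl)) (span-mono F (h ∘ there) p))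

    span-⊆ : ∀ F {F′} → (∀ {e} → e ∈ F → e ∈ F′) → ∀ {x} → Span F x → Span F′ x
    span-⊆ F h = span-mono F (span-∈ ∘ h)

    span-shift : ∀ F {x y} → Span F x → Span F (x ⊕ y) → Span F y
    span-shift F {x} {y} p p′ = subst (Span F) (⊕-cancel x y) (span-⊕ F p p′)

    _≈_ : List Γ → List Γ → Set
    F ≈ F′ = (∀ {x} → Span F x → Span F′ x) × (∀ {x} → Span F′ x → Span F x)

    data Independent : List Γ → Set where
      []  : Independent []
      _∷_ : ∀ {e F} → ¬ Span F (q e) → Independent F → Independent (e ∷ F)

    combine : ∀ F → (Fin (length F) → Fin 2) → Vec Bool r
    combine []      b = 0v
    combine (e ∷ F) b with b zero
    ... | zero  = combine F (b ∘ suc)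
    ... | suc _ = q e ⊕ combine F (b ∘ suc)

    combine-span : ∀ F b → Span F (combine F b)
    combine-span []      b = refl
    combine-span (e ∷ F) b with b zero
    ... | zero  = inj₁ (combine-span F (b ∘ suc))
    ... | suc _ = inj₂ (subst (Span F) (sym (⊕-cancel (q e) _)) (combine-span F (b ∘ suc)))

    -- At the first entry where `b` and `b′` differ, equality of the sums would put `q e` into the
    -- span of the entries after it.
    combine-injective : ∀ {F} → Independent F → ∀ {b b′} → combine F b ≡ combine F b′ → b ≗ b′
    combine-injective {e ∷ F} (e∉ ∷ ind) {b} {b′} eq i with b zero in b₀ | b′ zero in b₀′
    combine-injective {e ∷ F} (e∉ ∷ ind) {b} {b′} eq zero    | zero     | zero     = trans b₀ (sym b₀′)
    combine-injective {e ∷ F} (e∉ ∷ ind) {b} {b′} eq (suc i) | zero     | zero     = combine-injective ind eq i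
    combine-injective {e ∷ F} (e∉ ∷ ind) {b} {b′} eq zero    | suc zero | suc zero = trans b₀ (sym b₀′)
    combine-injective {e ∷ F} (e∉ ∷ ind) {b} {b′} eq (suc i) | suc _    | suc _    =
      combine-injective ind (trans (sym (⊕-cancel (q e) _)) (trans (cong (q e ⊕_) eq) (⊕-cancel (q e) _))) i
    ... | zero  | suc _ = contradiction
      (span-shift F (combine-span F (b′ ∘ suc))
        (subst (Span F) (trans eq (⊕-comm (q e) _)) (combine-span F (b ∘ suc)))) e∉
    ... | suc _ | zero  = contradiction
      (span-shift F (combine-span F (b ∘ suc))
        (subst (Span F) (trans (sym eq) (⊕-comm (q e) _)) (combine-span F (b′ ∘ suc)))) e∉

    -- Counting replaces dimension theory: the `2 ^ length F` subset sums are distinct among the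
    -- `2 ^ r` vectors.
    independent⇒length≤ : ∀ {F} → Independent F → length F ≤ r
    independent⇒length≤ {F} ind = ℕ.≮⇒≥ λ r<l → ℕ.<⇒≱ (ℕ.^-monoʳ-< 2 ℕ.≤-refl r<l) (Fin.injective⇒≤ code-injective)
      where
      bit : Bool → Fin 2
      bit false = zero
      bit true  = suc zero
      bit-injective : ∀ {a b} → bit a ≡ bit b → a ≡ b
      bit-injective {false} {false} _ = refl
      bit-injective {true}  {true}  _ = refl
      code : Fin (2 ^ length F) → Fin (2 ^ r)
      code x = Fin.funToFin (λ i → bit (Vec.lookup (combine F (Fin.finToFun x)) i))
      code-injective : Injective _≡_ _≡_ code
      code-injective {x} {y} eq = begin
        x                               ≡⟨ Fin.funToFin-finToFin {length F} x ⟨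
        Fin.funToFin {length F} (Fin.finToFun x) ≡⟨ funToFin-cong {length F} (combine-injective ind combine≡) ⟩
        Fin.funToFin {length F} (Fin.finToFun y) ≡⟨ Fin.funToFin-finToFin {length F} y ⟩
        y                               ∎
        where
        open ≡-Reasoning
        lookup≡ : ∀ i → Vec.lookup (combine F (Fin.finToFun x)) i ≡ Vec.lookup (combine F (Fin.finToFun y)) i
        lookup≡ i = bit-injective (trans (sym (Fin.finToFun-funToFin (λ i → bit (Vec.lookup (combine F (Fin.finToFun x)) i)) i))
          (trans (cong (λ z → Fin.finToFun z i) eq) (Fin.finToFun-funToFin (λ i → bit (Vec.lookup (combine F (Fin.finToFun y)) i)) i)))
        combine≡ : combine F (Fin.finToFun x) ≡ combine F (Fin.finToFun y)
        combine≡ = trans (sym (Vec.tabulate∘lookup _)) (trans (Vec.tabulate-cong lookup≡) (Vec.tabulate∘lookup _))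

    -- Steinitz exchange. Entries of `A` are set aside while the rest still spans `x`. The first `a`
    -- without which this fails must occur in the representation of `x` by what is left, so `q a`
    -- can be solved for in terms of `q e` and the others. As `N` alone does not span `x`, such an
    -- `a` is met before `A` runs out.
    pivot : ∀ A N x e → q e ≡ x → Span (A ++ N) x → ¬ Span N x →
            ∃[ a ] ∃[ A′ ] A ↭ a ∷ A′ × Span (A′ ++ e ∷ N) (q a)
    pivot []      N x e eq p p∉ = contradiction p p∉
    pivot (a ∷ A) N x e eq p p∉ with span? (A ++ N) x
    ... | yes p′ = let (b , A′ , A↭ , s) = pivot A N x e eq p′ p∉ in
      b , a ∷ A′ , ↭-trans (prep a A↭) (swap a b ↭-refl) , inj₁ s
    pivot (a ∷ A) N x e refl (inj₁ p) p∉ | no p∉′ = contradiction p p∉′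
    pivot (a ∷ A) N x e refl (inj₂ p) p∉ | no p∉′ = a , A , ↭-refl ,
      span-shift (A ++ e ∷ N) (span-∈ (∈-++⁺ʳ A (here refl)))
        (subst (Span (A ++ e ∷ N)) (⊕-comm (q a) (q e)) (span-⊆ (A ++ N) bigger p))
      where
      bigger : ∀ {d} → d ∈ A ++ N → d ∈ A ++ e ∷ N
      bigger i with ∈-++⁻ A i
      ... | inj₁ j = ∈-++⁺ˡ j
      ... | inj₂ j = ∈-++⁺ʳ A (there j)

  -- Disjoint families of gadgets

  Apart : ∀ {A : Set} → List A → List A → Set
  Apart xs ys = ∀ v → v ∈ xs → v ∉ ys

  apart-sym : ∀ {A : Set} {xs ys : List A} → Apart xs ys → Apart ys xs
  apart-sym d v i j = d v j i

  apart? : ∀ {n} (xs ys : List (Fin n)) → Dec (Apart xs ys)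
  apart? xs ys = map′ (λ d v i j → d (i , j)) (λ d {v} (i , j) → d v i j) (disjoint? Fin._≟_ xs ys)

  record Gadget (n : ℕ) : Set where
    constructor gadget
    field
      a b c d : Fin n

  verts : ∀ {n} → Gadget n → List (Fin n)
  verts (gadget a b c d) = a ∷ b ∷ c ∷ d ∷ []

  support : ∀ {n} → List (Gadget n) → List (Fin n)
  support = concatMap verts

  length-support : ∀ {n} (F : List (Gadget n)) → length (support F) ≡ 4 * length F
  length-support []      = refl
  length-support (e ∷ F) = trans (cong (4 +_) (length-support F)) (sym (ℕ.*-suc 4 (length F)))

  -- Distinctness of the four vertices is demanded here and not in `Gadget`, so that `search` can
  -- run through all quadruples.
  Good : ∀ {n} → List (Fin n) → Gadget n → Set
  Good Y e = Unique (verts e) × Apart (verts e) Y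

  Family : ∀ {n} → List (Fin n) → List (Gadget n) → Set
  Family Y F = All (Good Y) F × AllPairs (λ e e′ → Apart (verts e) (verts e′)) F

  AllPairs-resp-↭ : ∀ {A : Set} {R : A → A → Set} → (∀ {x y} → R x y → R y x) →
                    ∀ {xs ys} → xs ↭ ys → AllPairs R xs → AllPairs R ys
  AllPairs-resp-↭ {A} {R} R-sym p =
    PermutationS.AllPairs-resp-↭ (setoid A) R-sym (subst (R _) , subst (λ x → R x _)) (↭⇒↭ₛ p)

  family-resp-↭ : ∀ {n} {Y : List (Fin n)} {F F′} → F ↭ F′ → Family Y F → Family Y F′
  family-resp-↭ p (good , disj) =
    All-resp-↭ p good , AllPairs-resp-↭ apart-sym p disj

  AllPairs-++⁻ : ∀ {A : Set} {R : A → A → Set} xs {ys} → AllPairs R (xs ++ ys) →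
                 AllPairs R xs × AllPairs R ys × All (λ x → All (R x) ys) xs
  AllPairs-++⁻ []       ps       = [] , ps , []
  AllPairs-++⁻ (x ∷ xs) (p ∷ ps) =
    let (ps₁ , ps₂ , ps₁₂) = AllPairs-++⁻ xs ps
    in All.++⁻ˡ xs p ∷ ps₁ , ps₂ , All.++⁻ʳ xs p ∷ ps₁₂

  apart-++⁺ : ∀ {A : Set} {xs ys zs : List A} → Apart xs ys → Apart xs zs → Apart xs (ys ++ zs)
  apart-++⁺ {ys = ys} d d′ v i j with ∈-++⁻ ys j
  ... | inj₁ k = d v i k
  ... | inj₂ k = d′ v i k

  apart-++⁻ˡ : ∀ {A : Set} {xs ys zs : List A} → Apart xs (ys ++ zs) → Apart xs ys
  apart-++⁻ˡ d v i j = d v i (∈-++⁺ˡ j)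

  apart-++⁻ʳ : ∀ {A : Set} {xs} ys {zs : List A} → Apart xs (ys ++ zs) → Apart xs zs
  apart-++⁻ʳ ys d v i j = d v i (∈-++⁺ʳ ys j)

  apart-support⁺ : ∀ {n} {xs : List (Fin n)} {F} → All (λ e → Apart xs (verts e)) F → Apart xs (support F)
  apart-support⁺ {F = F} ds v i j with All.lookupAny ds (∈-concatMap⁻ verts {xs = F} j)
  ... | (d , k) = d v i k

  apart-support⁻ : ∀ {n} {xs : List (Fin n)} F → Apart xs (support F) → All (λ e → Apart xs (verts e)) F
  apart-support⁻ []      d = []
  apart-support⁻ (e ∷ F) d = apart-++⁻ˡ d ∷ apart-support⁻ F (apart-++⁻ʳ (verts e) d)

  split-↭ : ∀ {A : Set} {P : A → Set} (P? : ∀ x → Dec (P x)) xs →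
            ∃[ ys ] ∃[ zs ] xs ↭ ys ++ zs × All P zs
  split-↭ P? []       = [] , [] , ↭-refl , []
  split-↭ P? (x ∷ xs) with split-↭ P? xs | P? x
  ... | ys , zs , p , ps | yes px = ys , x ∷ zs , ↭-trans (prep x p) (↭-sym (shift x ys zs)) , px ∷ ps
  ... | ys , zs , p , ps | no  _  = x ∷ ys , zs , prep x p , ps

  -- The augmenting argument

  module Disentangle {n r : ℕ} (q : Gadget n → Vec Bool r) where

    open Spans q

    -- `ℓ` is the number of gadgets at the start, and each gadget given up pays for eight deletions.
    -- Keeping `8 * length family` in `size` later bounds the deleted vertices and the support of
    -- the family together.
    record Core (Y : List (Fin n)) (ℓ : ℕ) : Set where
      field
        deleted : List (Fin n)
        family  : List (Gadget n)
        size    : length deleted + 8 * length family ≤ 8 * ℓ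
        good    : Family (deleted ++ Y) family
        covers  : ∀ e → Good (deleted ++ Y) e → Span family (q e)

    -- Members may have been exchanged: only their number and their span are those of `F`. This is
    -- enough for `new` to enlarge the span.
    record Extension (Y : List (Fin n)) (F : List (Gadget n)) : Set where
      field
        family : List (Gadget n)
        new    : Gadget n
        size   : length family ≡ length F
        spans  : family ≈ F
        good   : Family Y (new ∷ family)
        new∉   : ¬ Span family (q new)

    Outcome : List (Fin n) → List (Gadget n) → Set
    Outcome Y F = Core Y (length F) ⊎ Extension Y F

    outcome-resp : ∀ {Y F F′} → length F ≡ length F′ → F ≈ F′ → Outcome Y F → Outcome Y F′
    outcome-resp {Y} eq _ (inj₁ c) = inj₁ (subst (Core Y) eq c)
    outcome-resp eq (f , g) (inj₂ x) = inj₂ record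
      { family = family ; new = new ; size = trans size eq
      ; spans = f ∘ proj₁ spans , proj₂ spans ∘ g
      ; good = good ; new∉ = new∉ }
      where open Extension x

    ≈-↭ : ∀ {F F′} → F ↭ F′ → F ≈ F′
    ≈-↭ {F} {F′} p = span-⊆ F (∈-resp-↭ p) , span-⊆ F′ (∈-resp-↭ (↭-sym p))

    ≈-trans : ∀ {F F′ F″} → F ≈ F′ → F′ ≈ F″ → F ≈ F″
    ≈-trans (f , g) (f′ , g′) = f′ ∘ f , g ∘ g′

    span-++ˡ : ∀ A {F F′} → F ≈ F′ → (A ++ F) ≈ (A ++ F′)
    span-++ˡ A {F} {F′} (f , g) = half F F′ f , half F′ F g
      where
      half : ∀ F F′ → (∀ {x} → Span F x → Span F′ x) → ∀ {x} → Span (A ++ F) x → Span (A ++ F′) x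
      half F F′ f = span-mono (A ++ F) λ i → go (∈-++⁻ A i)
        where
        go : ∀ {d} → d ∈ A ⊎ d ∈ F → Span (A ++ F′) (q d)
        go (inj₁ i) = span-∈ (∈-++⁺ˡ i)
        go (inj₂ i) = span-⊆ F′ (∈-++⁺ʳ A) (f (span-∈ i))

    good? : ∀ Y (e : Gadget n) → Dec (Good Y e)
    good? Y e = unique? Fin._≟_ (verts e) ×-dec apart? (verts e) Y

    search : ∀ Y F → Dec (∃ λ e → Good Y e × ¬ Span F (q e))
    search Y F = map′ (λ (a , b , c , d , p) → gadget a b c d , p)
                      (λ (gadget a b c d , p) → a , b , c , d , p)
      (Fin.any? λ a → Fin.any? λ b → Fin.any? λ c → Fin.any? λ d →
        good? Y (gadget a b c d) ×-dec ¬? (span? F (q (gadget a b c d))))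

    -- Deleting the gadgets hit by some gadget e, and the vertices of e, costs
    -- 4 + 4 |A| ≤ 8 |A| vertices for |A| hit gadgets.
    deletion-size : ∀ {y f N} a → y + 8 * f ≤ 8 * N → (y + (4 + 4 * suc a)) + 8 * f ≤ 8 * (suc a + N)
    deletion-size {y} {f} {N} a h = begin
      (y + (4 + 4 * suc a)) + 8 * f ≡⟨ solve 3 (λ y a f → (y :+ (con 4 :+ con 4 :* (con 1 :+ a))) :+ con 8 :* f
                                         := (y :+ con 8 :* f) :+ (con 8 :+ con 4 :* a)) refl y a f ⟩
      (y + 8 * f) + (8 + 4 * a)     ≤⟨ ℕ.+-mono-≤ h (ℕ.+-monoʳ-≤ 8 (ℕ.*-monoˡ-≤ a (ℕ.m≤m+n 4 4))) ⟩
      8 * N + (8 + 8 * a)           ≡⟨ solve 2 (λ a N → con 8 :* N :+ (con 8 :+ con 8 :* a)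
                                         := con 8 :* ((con 1 :+ a) :+ N)) refl a N ⟩
      8 * (suc a + N)               ∎
      where
      open ℕ.≤-Reasoning
      open +-*-Solver

    -- With the vertices of `e` and `A` forbidden, whatever the recursive call returns for `N`
    -- avoids both, and `shrink` can merge it with `A` again.
    grow : ∀ {Y} {e : Gadget n} {A N} → Good Y e → All (λ d → Apart (verts e) (verts d)) N →
           Family Y (A ++ N) → Family (verts e ++ support A ++ Y) N
    grow {Y} {e} {A} e-good e-N (goods , disj) =
      let (_ , N-disj , A-N) = AllPairs-++⁻ A disj
      in All.zipWith (λ { ((u , d) , (d′ , d″)) →
           u , apart-++⁺ (apart-sym d′) (apart-++⁺ (apart-support⁺ (All.map apart-sym d″)) d) })
         (All.++⁻ʳ A goods , All.zip (e-N , All.tabulate λ i → All.map (λ ds → All.lookup ds i) A-N)) ,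
         N-disj

    shrink : ∀ {Y} {e : Gadget n} {A N} → Family Y A → Family (verts e ++ support A ++ Y) N →
             All (λ d → Apart (verts e) (verts d)) N × Family Y (A ++ N)
    shrink {Y} {e} {A} {N} (A-goods , A-disj) (goods , disj) =
      All.map (λ (_ , d) → apart-sym (apart-++⁻ˡ d)) goods ,
      All.++⁺ A-goods (All.map (λ (u , d) → u , apart-++⁻ʳ (support A) (apart-++⁻ʳ (verts e) d)) goods) ,
      AllPairs.++⁺ A-disj disj
        (All.tabulate λ {a} a∈A → All.map (λ (_ , d) →
          apart-sym (All.lookup (apart-support⁻ A (apart-++⁻ˡ (apart-++⁻ʳ (verts e) d))) a∈A)) goods)

    -- The gadget e is independent of A ++ N but meets (at most) the members of A.
    -- If N can be extended outside A by a gadget e′ depending on A ++ N, then e′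
    -- replaces some a ∈ A, so that e meets fewer members.
    attempt : ∀ ℓ → (∀ Y N → length N < ℓ → Family Y N → Outcome Y N) →
              ∀ k Y e A N → length A ≤ k → length (A ++ N) ≡ ℓ →
              Good Y e → All (λ d → Apart (verts e) (verts d)) N →
              Family Y (A ++ N) → ¬ Span (A ++ N) (q e) → Outcome Y (A ++ N)
    attempt ℓ rec k Y e [] N _ _ e-good N-disj (goods , disj) e∉ = inj₂ record
      { family = N ; new = e ; size = refl ; spans = id , id
      ; good = e-good ∷ goods , N-disj ∷ disj ; new∉ = e∉ }
    attempt ℓ rec (suc k) Y e A@(a ∷ A₀) N (s≤s A≤k) F≡ℓ e-good N-disj fam@(goods , disj) e∉
      -- `A` is non-empty, so `N` has fewer than `ℓ` members and the outer induction applies.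
      with rec (verts e ++ support A ++ Y) N
             (subst (length N <_) (trans (sym (List.length-++ A)) F≡ℓ) (s≤s (ℕ.m≤n+m (length N) (length A₀))))
             (grow {A = A} e-good N-disj fam)
    ... | inj₁ core = inj₁ record
      { deleted = deleted ++ verts e ++ support A
      ; family = family
      ; size = subst₂ (λ x y → x + 8 * length family ≤ 8 * y)
          (sym (trans (List.length-++ deleted) (cong (length deleted +_) (cong (4 +_) (length-support A)))))
          (sym (List.length-++ A))
          (deletion-size {length deleted} {length family} (length A₀) size)
      ; good = subst (λ Z → Family Z family) assoc good
      ; covers = λ d → covers d ∘ subst (λ Z → Good Z d) (sym assoc) }
      where
      open Core core
      assoc : deleted ++ verts e ++ support A ++ Y ≡ (deleted ++ verts e ++ support A) ++ Y
      assoc = trans (cong (deleted ++_) (sym (List.++-assoc (verts e) (support A) Y)))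
                    (sym (List.++-assoc deleted (verts e ++ support A) Y))
    ... | inj₂ ext with span? (A ++ Extension.family ext) (q (Extension.new ext))
    -- `new` is outside the span even with `A` included, so all of `A` can stay.
    ... | no new∉′ = inj₂ record
      { family = A ++ family ; new = new ; size = length≡ ; spans = spans≈
      ; good = family-resp-↭ (shift new A family) (proj₂ merged)
      ; new∉ = new∉′ }
      where
      open Extension ext
      merged = shrink {e = e} {A = A} (All.++⁻ˡ A goods , proj₁ (AllPairs-++⁻ A disj)) good
      length≡ : length (A ++ family) ≡ length (A ++ N)
      length≡ = trans (List.length-++ A) (trans (cong (length A +_) size) (sym (List.length-++ A)))
      spans≈ : (A ++ family) ≈ (A ++ N)
      spans≈ = span-++ˡ A spans
    ... | yes new∈ with pivot A (Extension.family ext) _ (Extension.new ext) refl new∈ (Extension.new∉ ext)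
    -- The total length stays `ℓ`, so this recursion is on `k`: `b` leaves the part that may meet
    -- `e`, and `new` joins the part that avoids it.
    ... | b , A′ , A↭ , b∈ = outcome-resp length≡ spans≈
      (attempt ℓ rec k Y e A′ (new ∷ family) A′≤k (trans length≡ F≡ℓ) e-good (proj₁ merged) fam′
        (e∉ ∘ proj₁ spans≈))
      where
      open Extension ext
      merged = shrink {e = e} {A = A} (All.++⁻ˡ A goods , proj₁ (AllPairs-++⁻ A disj)) good
      A′≤k : length A′ ≤ k
      A′≤k = subst (_≤ k) (ℕ.suc-injective (↭-length A↭)) A≤k
      length≡ : length (A′ ++ new ∷ family) ≡ length (A ++ N)
      length≡ = begin
        length (A′ ++ new ∷ family)     ≡⟨ ↭-length (shift new A′ family) ⟩
        suc (length (A′ ++ family))     ≡⟨ cong suc (trans (List.length-++ A′) (cong (length A′ +_) size)) ⟩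
        suc (length A′) + length N      ≡⟨ cong (_+ length N) (↭-length A↭) ⟨
        length A + length N             ≡⟨ List.length-++ A ⟨
        length (A ++ N)                 ∎
        where open ≡-Reasoning
      fam′ : Family Y (A′ ++ new ∷ family)
      fam′ = family-resp-↭ (↭-sym (shift new A′ family)) (drop-second new-fam↭)
        where
        new-fam↭ : Family Y (new ∷ b ∷ A′ ++ family)
        new-fam↭ = family-resp-↭ (prep new (++⁺ʳ family A↭)) (family-resp-↭ (shift new A family) (proj₂ merged))
        drop-second : ∀ {d d′ F} → Family Y (d ∷ d′ ∷ F) → Family Y (d ∷ F)
        drop-second (g ∷ _ ∷ gs , (_ ∷ ps) ∷ _ ∷ pss) = g ∷ gs , ps ∷ pss
      spans≈ : (A′ ++ new ∷ family) ≈ (A ++ N)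
      spans≈ = ≈-trans exchange (span-++ˡ A spans)
        where
        old⇒new : ∀ {d} → d ∈ A ++ family → Span (A′ ++ new ∷ family) (q d)
        old⇒new i with ∈-resp-↭ (++⁺ʳ family A↭) i
        ... | here refl = b∈
        ... | there j   = span-∈ (∈-resp-↭ (↭-sym (shift new A′ family)) (there j))
        new⇒old : ∀ {d} → d ∈ A′ ++ new ∷ family → Span (A ++ family) (q d)
        new⇒old i with ∈-resp-↭ (shift new A′ family) i
        ... | here refl = new∈
        ... | there j   = span-∈ (∈-resp-↭ (↭-sym (++⁺ʳ family A↭)) (there j))
        exchange : (A′ ++ new ∷ family) ≈ (A ++ family)
        exchange = span-mono (A′ ++ new ∷ family) new⇒old , span-mono (A ++ family) old⇒new

    -- If no admissible gadget leaves the span, nothing has to be deleted. Otherwise such a gadget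
    -- starts an attempt, and the induction on the length of `F` answers the attempt's calls on
    -- smaller families.
    solve : ∀ m Y F → length F < m → Family Y F → Outcome Y F
    solve (suc m) Y F (s≤s F≤m) fam with search Y F
    ... | no none = inj₁ record
      { deleted = [] ; family = F ; size = ℕ.≤-refl ; good = fam
      ; covers = λ e e-good → decidable-stable (span? F (q e)) (λ e∉ → none (e , e-good , e∉)) }
    ... | yes (e , e-good , e∉) =
      let (A , N , p , N-disj) = split-↭ (λ d → apart? (verts e) (verts d)) F
          (to , from) = ≈-↭ p
      in outcome-resp (sym (↭-length p)) (from , to)
           (attempt (length F) (λ Y N N<F → solve m Y N (ℕ.<-≤-trans N<F F≤m))
             (length A) Y e A N ℕ.≤-refl (sym (↭-length p)) e-good N-disj
             (family-resp-↭ p fam) (e∉ ∘ from))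

    -- R is a basis of the span of F kept only to bound the length of F by r.
    augment : ∀ k F R → r ≤ length F + k → Family [] F → Independent R → R ≈ F → length R ≡ length F →
              ∃[ ℓ ] ℓ ≤ r × Core [] ℓ
    augment k F R r≤ fam ind R≈F eq with solve (suc (length F)) [] F ℕ.≤-refl fam
    ... | inj₁ core = length F , subst (_≤ r) eq (independent⇒length≤ ind) , core
    augment zero F R r≤ fam ind R≈F eq | inj₂ ext = contradiction (independent⇒length≤ (e∉R ∷ ind))
      (ℕ.<⇒≱ (s≤s (subst (r ≤_) (trans (ℕ.+-identityʳ _) (sym eq)) r≤)))
      where
      open Extension ext
      e∉R : ¬ Span R (q new)
      e∉R = new∉ ∘ proj₂ spans ∘ proj₁ R≈F
    augment (suc k) F R r≤ fam ind R≈F eq | inj₂ ext =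
      augment k (new ∷ family) (new ∷ R)
        (subst (r ≤_) (trans (ℕ.+-suc (length F) k) (cong (λ z → suc (z + k)) (sym size))) r≤)
        good (e∉R ∷ ind) R≈F′ (cong suc (trans eq (sym size)))
      where
      open Extension ext
      e∉R : ¬ Span R (q new)
      e∉R = new∉ ∘ proj₂ spans ∘ proj₁ R≈F
      R≈F′ : (new ∷ R) ≈ (new ∷ family)
      R≈F′ = (λ { (inj₁ p) → inj₁ (proj₂ spans (proj₁ R≈F p)) ; (inj₂ p) → inj₂ (proj₂ spans (proj₁ R≈F p)) }) ,
             (λ { (inj₁ p) → inj₁ (proj₂ R≈F (proj₁ spans p)) ; (inj₂ p) → inj₂ (proj₂ R≈F (proj₁ spans p)) })

    core : ∃[ ℓ ] ℓ ≤ r × Core [] ℓ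
    core = augment r [] [] ℕ.≤-refl ([] , []) [] (id , id) refl

  -- Sums along walks and re-routing of gadgets

  -- Generic in the operation, so that one traversal gives vector sums, parities and edge counts. A
  -- cycle is the case `z = u`.
  walk : ∀ {A M : Set} → (M → M → M) → (A → A → M) → A → List A → A → M
  walk _∙_ f u []      z = f u z
  walk _∙_ f u (v ∷ L) z = f u v ∙ walk _∙_ f v L z

  infixr 8 _·_

  _·_ : ∀ {r} → ℕ → Vec Bool r → Vec Bool r
  zero  · x = 0v
  suc k · x = x ⊕ k · x

  [k*2]·x≡0 : ∀ {r} k (x : Vec Bool r) → (k * 2) · x ≡ 0v
  [k*2]·x≡0 zero    x = refl
  [k*2]·x≡0 (suc k) x = trans (⊕-cancel x _) ([k*2]·x≡0 k x)

  toggle-on : ∀ {r} (va ab ac bc bd cd x t : Vec Bool r) →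
    va ⊕ (ac ⊕ (bc ⊕ (bd ⊕ (x ⊕ ((ab ⊕ cd ⊕ ac ⊕ bd) ⊕ t))))) ≡ (va ⊕ (ab ⊕ (bc ⊕ (cd ⊕ x)))) ⊕ t
  toggle-on [] [] [] [] [] [] [] [] = refl
  toggle-on (va ∷ vas) (ab ∷ abs) (ac ∷ acs) (bc ∷ bcs) (bd ∷ bds) (cd ∷ cds) (x ∷ xs) (t ∷ ts) = cong₂ _∷_
    (B.solve 8 (λ va ab ac bc bd cd x t →
      va B.:+ (ac B.:+ (bc B.:+ (bd B.:+ (x B.:+ ((ab B.:+ cd B.:+ ac B.:+ bd) B.:+ t)))))
      B.:= (va B.:+ (ab B.:+ (bc B.:+ (cd B.:+ x)))) B.:+ t) refl va ab ac bc bd cd x t)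
    (toggle-on vas abs acs bcs bds cds xs ts)

  toggle-off : ∀ {r} (va ab bc cd x t : Vec Bool r) →
    va ⊕ (ab ⊕ (bc ⊕ (cd ⊕ (x ⊕ t)))) ≡ (va ⊕ (ab ⊕ (bc ⊕ (cd ⊕ x)))) ⊕ t
  toggle-off [] [] [] [] [] [] = refl
  toggle-off (va ∷ vas) (ab ∷ abs) (bc ∷ bcs) (cd ∷ cds) (x ∷ xs) (t ∷ ts) = cong₂ _∷_
    (B.solve 6 (λ va ab bc cd x t →
      va B.:+ (ab B.:+ (bc B.:+ (cd B.:+ (x B.:+ t))))
      B.:= (va B.:+ (ab B.:+ (bc B.:+ (cd B.:+ x)))) B.:+ t) refl va ab bc cd x t)
    (toggle-off vas abs bcs cds xs ts)

  edge-single : ∀ {r} (uv gu gv k wv t : Vec Bool r) →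
    (uv ⊕ (gu ⊕ gv ⊕ k)) ⊕ (wv ⊕ (gv ⊕ t)) ≡ (uv ⊕ wv) ⊕ (gu ⊕ (k ⊕ t))
  edge-single [] [] [] [] [] [] = refl
  edge-single (uv ∷ uvs) (gu ∷ gus) (gv ∷ gvs) (k ∷ ks) (wv ∷ wvs) (t ∷ ts) = cong₂ _∷_
    (B.solve 6 (λ uv gu gv k wv t →
      (uv B.:+ (gu B.:+ gv B.:+ k)) B.:+ (wv B.:+ (gv B.:+ t))
      B.:= (uv B.:+ wv) B.:+ (gu B.:+ (k B.:+ t))) refl uv gu gv k wv t)
    (edge-single uvs gus gvs ks wvs ts)

  four-cycle : ∀ {r} (uv uv′ gu gv gv′ : Vec Bool r) →
    uv ⊕ gv′ ⊕ uv′ ⊕ gv ≡ (uv ⊕ gu ⊕ gv) ⊕ (uv′ ⊕ gu ⊕ gv′)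
  four-cycle [] [] [] [] [] = refl
  four-cycle (uv ∷ uvs) (uv′ ∷ uvs′) (gu ∷ gus) (gv ∷ gvs) (gv′ ∷ gvs′) = cong₂ _∷_
    (B.solve 5 (λ uv uv′ gu gv gv′ →
      uv B.:+ gv′ B.:+ uv′ B.:+ gv B.:= (uv B.:+ gu B.:+ gv) B.:+ (uv′ B.:+ gu B.:+ gv′))
      refl uv uv′ gu gv gv′)
    (four-cycle uvs uvs′ gus gvs gvs′)

  module Balance {n r : ℕ} (f : Fin n → Fin n → Vec Bool r) (f-sym : ∀ u v → f u v ≡ f v u) where

    -- The edges in which the routes abcd and acbd differ; they form the 4-cycle a b d c.
    q : Gadget n → Vec Bool r
    q (gadget a b c d) = f a b ⊕ f c d ⊕ f a c ⊕ f b d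

    open Spans q

    sumAlong : Fin n → List (Fin n) → Fin n → Vec Bool r
    sumAlong = walk _⊕_ f

    -- The proof of `Span F t` chooses the route of each gadget. Both routes run from `a` to `d` and
    -- use the edge between `b` and `c`, so the edges joining gadgets are untouched and each switch
    -- adds exactly `q`.
    toggle : ∀ F v R z {t} → Span F t →
             ∃[ L ] L ↭ support F × sumAlong v (L ++ R) z ≡ sumAlong v (support F ++ R) z ⊕ t
    toggle []      v R z refl = [] , ↭-refl , sym (⊕-identityʳ _)
    toggle (gadget a b c d ∷ F) v R z {t} (inj₁ p) =
      let (L , L↭ , eq) = toggle F d R z p in
      a ∷ b ∷ c ∷ d ∷ L , prep a (prep b (prep c (prep d L↭))) ,
      trans (cong (λ x → f v a ⊕ (f a b ⊕ (f b c ⊕ (f c d ⊕ x)))) eq)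
            (toggle-off (f v a) (f a b) (f b c) (f c d) (sumAlong d (support F ++ R) z) t)
    toggle (gadget a b c d ∷ F) v R z {t} (inj₂ p) =
      let (L , L↭ , eq) = toggle F d R z p in
      a ∷ c ∷ b ∷ d ∷ L , prep a (swap c b (prep d L↭)) ,
      trans (cong₂ (λ x y → f v a ⊕ (f a c ⊕ (x ⊕ (f b d ⊕ y)))) (f-sym c b) eq)
            (toggle-on (f v a) (f a b) (f a c) (f b c) (f b d) (f c d) (sumAlong d (support F ++ R) z) t)

    -- A cherry that is `OK` behaves like a single vertex: its two edges cancel, and its ends have
    -- the same potential.
    data Block : Set where
      single : Fin n → Block
      cherry : Fin n → Fin n → Fin n → Block

    flatten : List Block → List (Fin n)
    flatten []                  = []
    flatten (single v ∷ bs)     = v ∷ flatten bs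
    flatten (cherry w y w′ ∷ bs) = w ∷ y ∷ w′ ∷ flatten bs

    flatten-++ : ∀ bs bs′ → flatten (bs ++ bs′) ≡ flatten bs ++ flatten bs′
    flatten-++ []                   bs′ = refl
    flatten-++ (single v ∷ bs)      bs′ = cong (v ∷_) (flatten-++ bs bs′)
    flatten-++ (cherry w y w′ ∷ bs) bs′ = cong (λ L → w ∷ y ∷ w′ ∷ L) (flatten-++ bs bs′)

    flatten-singles : ∀ L → flatten (map single L) ≡ L
    flatten-singles []      = refl
    flatten-singles (v ∷ L) = cong (v ∷_) (flatten-singles L)

    -- Outside D every 4-cycle sum lies in the span, so there f u v is of the
    -- form g u + g v + κ modulo the span, where g u = f o u.
    module Potential (D : List (Fin n)) (F : List (Gadget n)) (covers : ∀ e → Good D e → Span F (q e))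
                     (o p p′ : Fin n) (o∉ : o ∉ D) where

      Inside : Fin n → Set
      Inside u = u ∉ D × u ≢ o

      -- With `g u = f o u`, the decomposition of `f` says that this sum is constant modulo the
      -- span.
      triangle : Fin n → Fin n → Vec Bool r
      triangle u v = f u v ⊕ f o u ⊕ f o v

      triangle-sym : ∀ u v → triangle u v ≡ triangle v u
      triangle-sym u v = begin
        f u v ⊕ f o u ⊕ f o v   ≡⟨ ⊕-assoc (f u v) (f o u) (f o v) ⟩
        f u v ⊕ (f o u ⊕ f o v) ≡⟨ cong₂ _⊕_ (f-sym u v) (⊕-comm (f o u) (f o v)) ⟩
        f v u ⊕ (f o v ⊕ f o u) ≡⟨ ⊕-assoc (f v u) (f o v) (f o u) ⟨
        f v u ⊕ f o v ⊕ f o u   ∎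
        where open ≡-Reasoning

      infix 4 _∼_
      _∼_ : Vec Bool r → Vec Bool r → Set
      x ∼ y = Span F (x ⊕ y)

      ∼-refl : ∀ {x} → x ∼ x
      ∼-refl {x} = subst (Span F) (sym (⊕-same x)) (span-0 F)

      ∼-trans : ∀ {x y z} → x ∼ y → y ∼ z → x ∼ z
      ∼-trans {x} {y} {z} s t = subst (Span F)
        (trans (⊕-assoc x y (y ⊕ z)) (cong (x ⊕_) (⊕-cancel y z))) (span-⊕ F s t)

      -- Two triangles at `o` that share the edge `o u` differ by the 4-cycle u v o v′, which comes
      -- from a gadget avoiding `D`.
      triangle-∼ : ∀ {u v v′} → Inside u → Inside v → Inside v′ → u ≢ v → u ≢ v′ → triangle u v ∼ triangle u v′
      triangle-∼ {u} {v} {v′} (u∉ , u≢o) (v∉ , v≢o) (v′∉ , v′≢o) u≢v u≢v′ with v Fin.≟ v′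
      ... | yes refl = ∼-refl
      ... | no v≢v′ = subst (Span F)
        (trans (cong₂ (λ x y → f u v ⊕ x ⊕ f u v′ ⊕ y) (f-sym v′ o) (f-sym v o))
               (four-cycle (f u v) (f u v′) (f o u) (f o v) (f o v′)))
        (covers (gadget u v v′ o)
          ( (u≢v ∷ u≢v′ ∷ u≢o ∷ []) ∷ (v≢v′ ∷ v≢o ∷ []) ∷ (v′≢o ∷ []) ∷ [] ∷ []
          , λ { _ (here refl) → u∉ ; _ (there (here refl)) → v∉
              ; _ (there (there (here refl))) → v′∉ ; _ (there (there (there (here refl)))) → o∉ }))

      κ : Vec Bool r
      κ = triangle p p′

      -- The edge uv is moved to pp′ one endpoint at a time, by way of up. The case `u = p` is
      -- separate because up is then no edge.
      triangle∼κ : Inside p → Inside p′ → p ≢ p′ → ∀ {u v} → Inside u → Inside v → u ≢ v → triangle u v ∼ κ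
      triangle∼κ p-in p′-in p≢p′ {u} {v} u-in v-in u≢v with u Fin.≟ p
      ... | yes refl = triangle-∼ u-in v-in p′-in u≢v p≢p′
      ... | no u≢p = ∼-trans (triangle-∼ u-in v-in p-in u≢v u≢p)
        (subst (_∼ κ) (triangle-sym p u) (triangle-∼ p-in u-in p′-in (≢-sym u≢p) p≢p′))

      data OK : Block → Set where
        single : ∀ {v} → Inside v → OK (single v)
        cherry : ∀ {w y w′} → Inside w → Inside w′ → f y w ≡ f y w′ → f o w ≡ f o w′ → OK (cherry w y w′)

      module _ (p-in : Inside p) (p′-in : Inside p′) (p≢p′ : p ≢ p′) where

        edge : ∀ {u v} → Inside u → Inside v → u ≢ v → Span F (f u v ⊕ (f o u ⊕ f o v ⊕ κ))
        edge {u} {v} u-in v-in u≢v = subst (Span F)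
          (trans (⊕-assoc (f u v ⊕ f o u) (f o v) κ) (trans (⊕-assoc (f u v) (f o u) _)
            (cong (f u v ⊕_) (sym (⊕-assoc (f o u) (f o v) κ)))))
          (triangle∼κ p-in p′-in p≢p′ u-in v-in u≢v)

        -- Entering a block adds `g u + g v + κ`, so the potentials telescope. The last edge, to
        -- `o`, adds the potential of the last vertex and no `κ`.
        sumAlong-blocks : ∀ {u} bs → Inside u → All OK bs → Unique (u ∷ flatten bs) →
                          Span F (sumAlong u (flatten bs) o ⊕ (f o u ⊕ length bs · κ))
        sumAlong-blocks {u} [] u-in [] uniq = subst (Span F)
          (sym (trans (cong₂ _⊕_ (f-sym u o) (⊕-identityʳ (f o u))) (⊕-same (f o u)))) (span-0 F)
        sumAlong-blocks {u} (single v ∷ bs) u-in (single v-in ∷ oks) ((u≢v ∷ _) ∷ uniq) = subst (Span F)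
          (edge-single (f u v) (f o u) (f o v) κ (sumAlong v (flatten bs) o) (length bs · κ))
          (span-⊕ F (edge u-in v-in u≢v) (sumAlong-blocks bs v-in oks uniq))
        sumAlong-blocks {u} (cherry w y w′ ∷ bs) u-in (cherry w-in w′-in y-eq o-eq ∷ oks) ((u≢w ∷ _) ∷ _ ∷ _ ∷ uniq) =
          subst (Span F) (begin
            (f u w ⊕ (f o u ⊕ f o w ⊕ κ)) ⊕ (S ⊕ (f o w′ ⊕ length bs · κ))
              ≡⟨ cong (λ x → (f u w ⊕ (f o u ⊕ f o w ⊕ κ)) ⊕ (S ⊕ (x ⊕ length bs · κ))) o-eq ⟨
            (f u w ⊕ (f o u ⊕ f o w ⊕ κ)) ⊕ (S ⊕ (f o w ⊕ length bs · κ))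
              ≡⟨ edge-single (f u w) (f o u) (f o w) κ S (length bs · κ) ⟩
            (f u w ⊕ S) ⊕ (f o u ⊕ (κ ⊕ length bs · κ))
              ≡⟨ cong (λ x → (f u w ⊕ x) ⊕ (f o u ⊕ (κ ⊕ length bs · κ))) skip ⟨
            (f u w ⊕ (f w y ⊕ (f y w′ ⊕ S))) ⊕ (f o u ⊕ (κ ⊕ length bs · κ)) ∎)
          (span-⊕ F (edge u-in w-in u≢w) (sumAlong-blocks bs w′-in oks uniq))
          where
          open ≡-Reasoning
          S = sumAlong w′ (flatten bs) o
          skip : f w y ⊕ (f y w′ ⊕ S) ≡ S
          skip = trans (cong (λ x → x ⊕ (f y w′ ⊕ S)) (trans (f-sym w y) y-eq)) (⊕-cancel (f y w′) S)

  -- Pigeonhole and permutations of lists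

  extract : ∀ {A : Set} (xs : List A) i → ∃[ zs ] xs ↭ lookup xs i ∷ zs
  extract (x ∷ xs) zero    = xs , ↭-refl
  extract (x ∷ xs) (suc i) = let (zs , p) = extract xs i in x ∷ zs , ↭-trans (prep x p) (swap x _ ↭-refl)

  extract₂ : ∀ {A : Set} (xs : List A) {i j} → i Fin.< j → ∃[ zs ] xs ↭ lookup xs i ∷ lookup xs j ∷ zs
  extract₂ (x ∷ xs) {zero}  {suc j} _ = let (zs , p) = extract xs j in zs , prep x p
  extract₂ (x ∷ xs) {suc i} {suc j} (s≤s i<j) = let (zs , p) = extract₂ xs i<j in
    x ∷ zs , ↭-trans (prep x p) (↭-trans (swap x _ ↭-refl) (prep _ (swap x _ ↭-refl)))

  pigeonhole : ∀ {A : Set} {m} (h : A → Fin m) xs → m < length xs →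
               ∃[ x ] ∃[ y ] ∃[ zs ] xs ↭ x ∷ y ∷ zs × h x ≡ h y
  pigeonhole h xs m< = let (i , j , i<j , eq) = Fin.pigeonhole m< (h ∘ lookup xs)
                           (zs , p) = extract₂ xs i<j
                       in lookup xs i , lookup xs j , zs , p , eq

  unique-resp-↭ : ∀ {A : Set} {xs ys : List A} → xs ↭ ys → Unique xs → Unique ys
  unique-resp-↭ p u = PermutationS.Unique-resp-↭ (setoid _) (↭⇒↭ₛ p) u

  unique-⊆⇒↭ : ∀ {A : Set} {xs ys : List A} → Unique xs → Unique ys →
               (∀ {x} → x ∈ xs → x ∈ ys) → (∀ {x} → x ∈ ys → x ∈ xs) → xs ↭ ys
  unique-⊆⇒↭ ux uy f g = ∼bag⇒↭ (unique∧set⇒bag ux uy (mk⇔ f g))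

  unique-support : ∀ {n} {Y : List (Fin n)} {F} → Family Y F → Unique (support F)
  unique-support {F = []}    _ = []
  unique-support {F = e ∷ F} ((u , _) ∷ goods , d ∷ ds) =
    Unique.++⁺ u (unique-support (goods , ds)) (λ (i , j) → apart-support⁺ d _ i j)

  apart-good : ∀ {n} {Y : List (Fin n)} {F} → All (Good Y) F → Apart (support F) Y
  apart-good {F = F} goods = apart-sym (apart-support⁺ (All.map (λ (_ , d) → apart-sym d) goods))

  unit : ∀ {r} → Fin r → Vec Bool r
  unit k = Vec.tabulate (λ i → does (k Fin.≟ i))

  -- Assembly of a balanced Hamilton cycle

  module EvenCycle {n r : ℕ} (c : Fin n → Fin n → Fin r) (c-sym : ∀ u v → c u v ≡ c v u) where

    f : Fin n → Fin n → Vec Bool r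
    f u v = unit (c u v)

    f-sym : ∀ u v → f u v ≡ f v u
    f-sym u v = cong unit (c-sym u v)

    open Balance f f-sym
    open Spans q
    open Disentangle q using (Core; module Core; core)

    -- A block has one or three vertices, so blocks and vertices agree in parity. In this way
    -- evenness of `n` passes to the number of terms `κ`.
    length-flatten : ∀ bs → ∃[ k ] length (flatten bs) ≡ k * 2 + length bs
    length-flatten [] = 0 , refl
    length-flatten (single v ∷ bs) = let (k , eq) = length-flatten bs in
      k , trans (cong suc eq) (sym (ℕ.+-suc (k * 2) (length bs)))
    length-flatten (cherry w y w′ ∷ bs) = let (k , eq) = length-flatten bs in
      suc k , trans (cong (3 +_) eq) (cong (2 +_) (sym (ℕ.+-suc (k * 2) (length bs))))

    BalancedCycle : Set
    BalancedCycle = ∃[ h ] ∃[ t ] allFin n ↭ h ∷ t × sumAlong h t h ≡ 0v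

    module Assemble (D : List (Fin n)) (F : List (Gadget n)) (covers : ∀ e → Good D e → Span F (q e))
                    (o p p′ : Fin n) (pool : List (Fin n))
                    (all↭ : allFin n ↭ o ∷ D ++ p ∷ p′ ∷ support F ++ pool) where

      uniq : Unique (o ∷ D ++ p ∷ p′ ∷ support F ++ pool)
      uniq = unique-resp-↭ all↭ (Unique.allFin⁺ n)

      o∉D++ : o ∉ D ++ p ∷ p′ ∷ support F ++ pool
      o∉D++ = Unique.Unique[x∷xs]⇒x∉xs uniq

      open Potential D F covers o p p′ (o∉D++ ∘ ∈-++⁺ˡ)

      inside : ∀ {v} → v ∈ p ∷ p′ ∷ support F ++ pool → Inside v
      inside {v} i = (λ v∈D → All.lookup (All.lookup apart v∈D) i refl) ,
                     (λ { refl → o∉D++ (∈-++⁺ʳ D i) })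
        where
        apart : All (λ x → All (x ≢_) (p ∷ p′ ∷ support F ++ pool)) D
        apart = proj₂ (proj₂ (AllPairs-++⁻ D (AllPairs.tail uniq)))

      p≢p′ : p ≢ p′
      p≢p′ = All.head (AllPairs.head (proj₁ (proj₂ (AllPairs-++⁻ D (AllPairs.tail uniq)))))

      -- The pigeonhole runs over the r² pairs of colours to `y` and to `o`; equal colours to `o`
      -- mean equal potentials. Each round needs more than r² vertices in the pool and uses up two.
      cherries : ∀ ys pool → All Inside pool → r * r + length ys * 2 < length pool →
                 ∃[ cs ] ∃[ rest ] flatten cs ++ rest ↭ ys ++ pool × All OK cs × All Inside rest
      cherries []       pool ins _ = [] , pool , ↭-refl , [] , ins
      cherries (y ∷ ys) pool ins h
        with pigeonhole (λ w → Fin.combine (c y w) (c o w)) pool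
               (ℕ.≤-<-trans (ℕ.m≤m+n (r * r) _) h)
      ... | w , w′ , pool′ , pool↭ , eq with All-resp-↭ pool↭ ins
      ... | w-in ∷ w′-in ∷ ins′ =
        let (cs , rest , cs↭ , oks , rest-in) = cherries ys pool′ ins′ smaller
        in cherry w y w′ ∷ cs , rest , perm cs↭ ,
           cherry w-in w′-in (cong unit (Fin.combine-injectiveˡ (c y w) (c o w) _ _ eq))
                             (cong unit (Fin.combine-injectiveʳ (c y w) (c o w) _ _ eq)) ∷ oks ,
           rest-in
        where
        smaller : r * r + length ys * 2 < length pool′
        smaller = ℕ.+-cancelˡ-< 2 _ _ (subst₂ _<_
          (trans (ℕ.+-suc (r * r) _) (cong suc (ℕ.+-suc (r * r) _))) (↭-length pool↭) h)
        perm : ∀ {L} → L ↭ ys ++ pool′ → w ∷ y ∷ w′ ∷ L ↭ y ∷ ys ++ pool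
        perm {L} L↭ = begin
          w ∷ y ∷ w′ ∷ L              ↭⟨ swap w y (prep w′ L↭) ⟩
          y ∷ w ∷ w′ ∷ ys ++ pool′    ↭⟨ prep y (shifts (w ∷ w′ ∷ []) ys) ⟩
          y ∷ ys ++ w ∷ w′ ∷ pool′    ↭⟨ prep y (++⁺ˡ ys pool↭) ⟨
          y ∷ ys ++ pool              ∎
          where open PermutationReasoning

      balanced : 2 ∣ n → r * r + length D * 2 < length pool → BalancedCycle
      balanced 2∣n enough with cherries D pool (All.tabulate (λ i → inside (there (there (∈-++⁺ʳ (support F) i))))) enough
      ... | cs , rest , cs↭ , cs-ok , rest-in =
        -- `start` is the sum of the whole cycle before re-routing. It lies in the span, so toggling
        -- by `start` itself cancels it.
        let (L , L↭ , eq) = toggle F p R o start-∈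
        in o , p ∷ L ++ R , ↭-trans all↭′ (prep o (prep p (++⁺ʳ R (↭-sym L↭)))) ,
           (begin
             f o p ⊕ sumAlong p (L ++ R) o                     ≡⟨ cong (f o p ⊕_) eq ⟩
             f o p ⊕ (sumAlong p (support F ++ R) o ⊕ start)   ≡⟨ ⊕-assoc (f o p) _ start ⟨
             start ⊕ start                                     ≡⟨ ⊕-same start ⟩
             0v                                                ∎)
        where
        open ≡-Reasoning
        R = flatten cs ++ p′ ∷ rest
        start = f o p ⊕ sumAlong p (support F ++ R) o
        bs = map single (support F) ++ cs ++ map single (p′ ∷ rest)

        flatten-bs : flatten bs ≡ support F ++ R
        flatten-bs = trans (flatten-++ (map single (support F)) _)
          (cong₂ _++_ (flatten-singles (support F))
            (trans (flatten-++ cs _) (cong (flatten cs ++_) (flatten-singles (p′ ∷ rest)))))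

        bs-ok : All OK bs
        bs-ok = All.++⁺ (All.map⁺ (All.tabulate {xs = support F} (λ i → single (inside (there (there (∈-++⁺ˡ i)))))))
          (All.++⁺ cs-ok (single (inside (there (here refl))) ∷ All.map⁺ (All.map single rest-in)))

        all↭′ : allFin n ↭ o ∷ p ∷ support F ++ R
        all↭′ = ↭-trans all↭ (prep o (P.begin
          D ++ p ∷ p′ ∷ support F ++ pool       P.↭⟨ shifts D (p ∷ p′ ∷ []) ⟩
          p ∷ p′ ∷ D ++ support F ++ pool       P.↭⟨ prep p (prep p′ (shifts D (support F))) ⟩
          p ∷ p′ ∷ support F ++ D ++ pool       P.↭⟨ prep p (prep p′ (++⁺ˡ (support F) cs↭)) ⟨
          p ∷ p′ ∷ support F ++ flatten cs ++ rest  P.↭⟨ prep p (shift p′ (support F) _) ⟨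
          p ∷ support F ++ p′ ∷ flatten cs ++ rest  P.↭⟨ prep p (++⁺ˡ (support F) (shift p′ (flatten cs) rest)) ⟨
          p ∷ support F ++ R                    P.∎))
          where module P = PermutationReasoning

        -- Besides the blocks the cycle contains only `o` and `p`, which do not change the parity.
        2∣bs : 2 ∣ length bs
        2∣bs = let (k , eq) = length-flatten bs in
          ∣m+n∣m⇒∣n (subst (2 ∣_)
            (trans (sym (List.length-tabulate {n = n} id)) (trans (↭-length all↭′)
              (cong (2 +_) (trans (cong length (sym flatten-bs)) eq)))) 2∣n)
            (divides (suc k) refl)

        no-κ : length bs · κ ≡ 0v
        no-κ = trans (cong (_· κ) (_∣_.equality 2∣bs)) ([k*2]·x≡0 (_∣_.quotient 2∣bs) κ)

        start-∈ : Span F start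
        start-∈ = subst (Span F)
          (trans (cong₂ (λ x y → sumAlong p x o ⊕ (f o p ⊕ y)) flatten-bs no-κ)
            (trans (cong (sumAlong p (support F ++ R) o ⊕_) (⊕-identityʳ (f o p))) (⊕-comm _ (f o p))))
          (sumAlong-blocks (inside (here refl)) (inside (there (here refl))) p≢p′ bs (inside (here refl)) bs-ok
            (subst (λ L → Unique (p ∷ L)) (sym flatten-bs) (AllPairs.tail (unique-resp-↭ all↭′ (Unique.allFin⁺ n)))))

    partition : ∀ {D F} → Unique D → Family D F → ∃[ pool ] allFin n ↭ D ++ support F ++ pool
    partition {D} {F} D! fam@(goods , _) = pool ,
      ↭-trans (unique-⊆⇒↭ (Unique.allFin⁺ n) whole! into (λ {x} _ → ∈-allFin x))
              (↭-reflexive (List.++-assoc D (support F) pool))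
      where
      used? = λ v → _∈?_ Fin._≟_ v (D ++ support F)
      pool = filter (¬? ∘ used?) (allFin n)
      whole! : Unique ((D ++ support F) ++ pool)
      whole! = Unique.++⁺ (Unique.++⁺ D! (unique-support fam) (λ (i , j) → apart-good goods _ j i))
        (Unique.filter⁺ (¬? ∘ used?) (Unique.allFin⁺ n))
        (λ (i , j) → proj₂ (∈-filter⁻ (¬? ∘ used?) {xs = allFin n} j) i)
      into : ∀ {x} → x ∈ allFin n → x ∈ (D ++ support F) ++ pool
      into {x} i with used? x
      ... | yes j = ∈-++⁺ˡ j
      ... | no ¬j = ∈-++⁺ʳ (D ++ support F) (∈-filter⁺ (¬? ∘ used?) i ¬j)

    -- At most `8 * r` vertices lie in `D` or in the gadgets, `cherries` needs a pool of more than
    -- `r * r + 2 * (8 * r)`, and three vertices serve as `o`, `p` and `p′`.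
    balancedCycle : 2 ∣ n → r * r + 24 * r + 4 ≤ n → BalancedCycle
    balancedCycle 2∣n big = go core
      where
      go : ∃[ ℓ ] ℓ ≤ r × Core [] ℓ → BalancedCycle
      go (ℓ , ℓ≤r , co) = finish (partition (deduplicate-! Fin._≟_ Y) fam)
        where
        open Core co renaming (family to F)
        Y = deleted ++ []
        -- `deleted` may list a vertex twice, but each vertex of `D` is placed on the cycle once.
        D = deduplicate Fin._≟_ Y
        D⊆Y : ∀ {v} → v ∈ D → v ∈ Y
        D⊆Y = ∈-deduplicate⁻ Fin._≟_ Y
        fam : Family D F
        fam = All.map (λ (u , a) → u , λ v i j → a v i (D⊆Y j)) (proj₁ good) , proj₂ good
        covers′ : ∀ e → Good D e → Span F (q e)
        covers′ e (u , a) = covers e (u , λ v i j → a v i (∈-deduplicate⁺ Fin._≟_ j))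
        D≤ : length D + 8 * length F ≤ 8 * r
        D≤ = begin
          length D + 8 * length F       ≤⟨ ℕ.+-monoˡ-≤ _ (List.length-deduplicate Fin._≟_ Y) ⟩
          length Y + 8 * length F       ≡⟨ cong (λ L → length L + 8 * length F) (List.++-identityʳ deleted) ⟩
          length deleted + 8 * length F ≤⟨ size ⟩
          8 * ℓ                         ≤⟨ ℕ.*-monoʳ-≤ 8 ℓ≤r ⟩
          8 * r                         ∎
          where open ℕ.≤-Reasoning
        finish : ∃[ pool ] allFin n ↭ D ++ support F ++ pool → BalancedCycle
        finish (pool , all↭) = pick pool all↭ pool-big
          where
          n≡ : n ≡ length D + (4 * length F + length pool)
          n≡ = trans (sym (List.length-tabulate {n = n} id)) (trans (↭-length all↭)
            (trans (List.length-++ D) (cong (length D +_)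
              (trans (List.length-++ (support F)) (cong (_+ length pool) (length-support F))))))
          pool-big : r * r + 16 * r + 4 ≤ length pool
          pool-big = ℕ.+-cancelˡ-≤ (8 * r) _ _ (begin
            8 * r + (r * r + 16 * r + 4)  ≡⟨ solve 1 (λ r → con 8 :* r :+ (r :* r :+ con 16 :* r :+ con 4)
                                               := r :* r :+ con 24 :* r :+ con 4) refl r ⟩
            r * r + 24 * r + 4            ≤⟨ big ⟩
            n                             ≡⟨ n≡ ⟩
            length D + (4 * length F + length pool)
              ≤⟨ ℕ.+-monoʳ-≤ (length D) (ℕ.+-monoˡ-≤ (length pool) (ℕ.*-monoˡ-≤ (length F) (ℕ.m≤m+n 4 4))) ⟩
            length D + (8 * length F + length pool) ≡⟨ ℕ.+-assoc (length D) _ _ ⟨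
            (length D + 8 * length F) + length pool ≤⟨ ℕ.+-monoˡ-≤ (length pool) D≤ ⟩
            8 * r + length pool           ∎)
            where
            open ℕ.≤-Reasoning
            open +-*-Solver
          pick : ∀ pool → allFin n ↭ D ++ support F ++ pool → r * r + 16 * r + 4 ≤ length pool → BalancedCycle
          pick []       _ h with () ← subst (_≤ 0) (ℕ.+-comm _ 4) h
          pick (_ ∷ []) _ h with s≤s () ← subst (_≤ 1) (ℕ.+-comm _ 4) h
          pick (_ ∷ _ ∷ []) _ h with s≤s (s≤s ()) ← subst (_≤ 2) (ℕ.+-comm _ 4) h
          pick (o ∷ p ∷ p′ ∷ pool) all↭ h = Assemble.balanced D F covers′ o p p′ pool
            (P.begin
              allFin n                                   P.↭⟨ all↭ ⟩
              D ++ support F ++ o ∷ p ∷ p′ ∷ pool        P.↭⟨ ++⁺ˡ D (shifts (support F) (o ∷ p ∷ p′ ∷ [])) ⟩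
              D ++ o ∷ p ∷ p′ ∷ support F ++ pool        P.↭⟨ shift o D _ ⟩
              o ∷ D ++ p ∷ p′ ∷ support F ++ pool        P.∎)
            2∣n (begin
              suc (r * r + length D * 2)     ≤⟨ s≤s (ℕ.+-monoʳ-≤ (r * r) (ℕ.*-monoˡ-≤ 2 (ℕ.≤-trans (ℕ.m≤m+n (length D) _) D≤))) ⟩
              suc (r * r + (8 * r) * 2)
                ≡⟨ cong suc (cong (r * r +_) (solve 1 (λ r → (con 8 :* r) :* con 2 := con 16 :* r) refl r)) ⟩
              suc (r * r + 16 * r)
                ≤⟨ ℕ.≤-pred (ℕ.≤-pred (ℕ.≤-pred (subst (_≤ suc (suc (suc (length pool)))) (ℕ.+-comm _ 4) h))) ⟩
              length pool                    ∎)
            where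
            open ℕ.≤-Reasoning
            open +-*-Solver
            module P = PermutationReasoning

  -- Counting the edges of a colour on a Hamilton cycle

  ⟦_⟧ : Bool → ℕ
  ⟦ true ⟧  = 1
  ⟦ false ⟧ = 0

  module _ {A : Set} {P : A → Set} (P? : Decidable P) where

    length-filter-tabulate : ∀ {n} (f : Fin n → A) →
                             length (filter P? (tabulate f)) ≡ sum (λ i → ⟦ does (P? (f i)) ⟧)
    length-filter-tabulate {zero}  f = refl
    length-filter-tabulate {suc n} f with does (P? (f zero))
    ... | true  = cong suc (length-filter-tabulate (f ∘ suc))
    ... | false = length-filter-tabulate (f ∘ suc)

  length-filter-pairs : ∀ {A B : Set} {P : A × B → Set} (P? : Decidable P) {m n} (f : Fin m → A) (g : Fin n → B) →
    length (filter P? (cartesianProduct (tabulate f) (tabulate g))) ≡ sum (λ i → sum (λ j → ⟦ does (P? (f i , g j)) ⟧))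
  length-filter-pairs P? {zero}  f g = refl
  length-filter-pairs P? {suc m} f g = begin
    length (filter P? (row ++ rest))              ≡⟨ cong length (List.filter-++ P? row rest) ⟩
    length (filter P? row ++ filter P? rest)      ≡⟨ List.length-++ (filter P? row) ⟩
    length (filter P? row) + length (filter P? rest)
      ≡⟨ cong₂ _+_ (trans (cong (length ∘ filter P?) (List.map-tabulate g (f zero ,_)))
                          (length-filter-tabulate P? (λ j → f zero , g j)))
                   (length-filter-pairs P? (f ∘ suc) g) ⟩
    _ ∎
    where
    open ≡-Reasoning
    row = map (f zero ,_) (tabulate g)
    rest = cartesianProduct (tabulate (f ∘ suc)) (tabulate g)

  sum-single : ∀ {n} (f : Fin n → ℕ) j → (∀ i → i ≢ j → f i ≡ 0) → sum f ≡ f j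
  sum-single {suc n} f j h = begin
    sum f                                   ≡⟨ sum-remove {i = j} f ⟩
    f j + sum (λ i → f (Fin.punchIn j i))   ≡⟨ cong (f j +_) (sum-cong-≗ (λ i → h _ (Fin.punchInᵢ≢i j i))) ⟩
    f j + sum {n} (λ _ → 0)                 ≡⟨ cong (f j +_) (sum-replicate-zero n) ⟩
    f j + 0                                 ≡⟨ ℕ.+-identityʳ (f j) ⟩
    f j                                     ∎
    where open ≡-Reasoning

  injective⇒surjective : ∀ {n} (f : Fin n → Fin n) → Injective _≡_ _≡_ f → ∀ j → ∃[ i ] f i ≡ j
  injective⇒surjective {suc n} f inj j with Fin.any? (λ i → f i Fin.≟ j)
  ... | yes p = p
  ... | no ¬p = contradiction
      (Fin.injective⇒≤ {f = λ i → Fin.punchOut {i = j} (λ eq → ¬p (i , sym eq))}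
        (λ eq → inj (Fin.punchOut-injective {i = j} (λ eq′ → ¬p (_ , sym eq′)) (λ eq′ → ¬p (_ , sym eq′)) eq))) ℕ.1+n≰n

  injective⇒permutation : ∀ {n} (f : Fin n → Fin n) → Injective _≡_ _≡_ f → Permutation′ n
  injective⇒permutation f inj =
    permutation f (proj₁ ∘ onto) (proj₂ ∘ onto) (λ i → inj (proj₂ (onto (f i))))
    where onto = injective⇒surjective f inj

  tour : ∀ {A M : Set} → (M → M → M) → (A → A → M) → ∀ {m} → (Fin (suc m) → A) → M
  tour _∙_ g h = walk _∙_ g (h zero) (tabulate (h ∘ suc)) (h zero)

  -- The values of h shifted by one place, with z after the last.
  shifted : ∀ {A : Set} {m} → (Fin (suc m) → A) → A → Fin (suc m) → A
  shifted {m = zero}  h z zero    = z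
  shifted {m = suc m} h z zero    = h (suc zero)
  shifted {m = suc m} h z (suc i) = shifted (h ∘ suc) z i

  sum-shifted : ∀ {A : Set} (g : A → A → ℕ) {m} (h : Fin (suc m) → A) z →
                sum (λ i → g (h i) (shifted h z i)) ≡ walk _+_ g (h zero) (tabulate (h ∘ suc)) z
  sum-shifted g {zero}  h z = ℕ.+-identityʳ _
  sum-shifted g {suc m} h z = cong (g (h zero) (h (suc zero)) +_) (sum-shifted g (h ∘ suc) z)

  shifted-∘ : ∀ {A B : Set} (f : A → B) {m} (h : Fin (suc m) → A) z i → shifted (f ∘ h) (f z) i ≡ f (shifted h z i)
  shifted-∘ f {zero}  h z zero    = refl
  shifted-∘ f {suc m} h z zero    = refl
  shifted-∘ f {suc m} h z (suc i) = shifted-∘ f (h ∘ suc) z i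

  shifted-cases : ∀ {A : Set} {m} (h : Fin (suc m) → A) z i →
    (∃[ j ] toℕ j ≡ suc (toℕ i) × shifted h z i ≡ h j) ⊎ (suc (toℕ i) ≡ suc m × shifted h z i ≡ z)
  shifted-cases {m = zero}  h z zero = inj₂ (refl , refl)
  shifted-cases {m = suc m} h z zero = inj₁ (suc zero , refl , refl)
  shifted-cases {m = suc m} h z (suc i) with shifted-cases (h ∘ suc) z i
  ... | inj₁ (j , eq , eq′) = inj₁ (suc j , cong suc eq , eq′)
  ... | inj₂ (eq , eq′)     = inj₂ (cong suc eq , eq′)

  next : ∀ {m} → Fin (suc m) → Fin (suc m)
  next = shifted id zero

  Next-next : ∀ {m} (i : Fin (suc m)) → Next i (next i)
  Next-next i with shifted-cases id zero i
  ... | inj₁ (j , eq , eq′) = inj₁ (trans (sym eq) (cong toℕ (sym eq′)))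
  ... | inj₂ (eq , eq′)     = inj₂ (eq , cong toℕ eq′)

  Next-unique : ∀ {n} {i j j′ : Fin n} → Next i j → Next i j′ → j ≡ j′
  Next-unique (inj₁ p) (inj₁ p′) = Fin.toℕ-injective (trans (sym p) p′)
  Next-unique {j = j} (inj₁ p) (inj₂ (p′ , _)) = contradiction (trans (sym p) p′) (ℕ.<⇒≢ (Fin.toℕ<n j))
  Next-unique {j′ = j} (inj₂ (p′ , _)) (inj₁ p) = contradiction (trans (sym p) p′) (ℕ.<⇒≢ (Fin.toℕ<n j))
  Next-unique (inj₂ (_ , p)) (inj₂ (_ , p′)) = Fin.toℕ-injective (trans p (sym p′))

  Next-asym : ∀ {n} → 3 ≤ n → {i j : Fin n} → Next i j → ¬ Next j i
  Next-asym _ (inj₁ p) (inj₁ p′) = ℕ.<-asym (ℕ.≤-reflexive p) (ℕ.≤-reflexive p′)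
  Next-asym 3≤n (inj₁ p) (inj₂ (p′ , z)) with trans (sym p′) (cong suc (trans (sym p) (cong suc z)))
  ... | refl = contradiction 3≤n λ { (s≤s (s≤s ())) }
  Next-asym 3≤n (inj₂ (p , z)) (inj₁ p′) with trans (sym p) (cong suc (trans (sym p′) (cong suc z)))
  ... | refl = contradiction 3≤n λ { (s≤s (s≤s ())) }
  Next-asym 3≤n (inj₂ (p , z)) (inj₂ (_ , z′)) with trans (sym p) (cong suc z′)
  ... | refl = contradiction 3≤n λ { (s≤s ()) }

  does⇒ : ∀ {P : Set} (p? : Dec P) → does p? ≡ true → P
  does⇒ (yes p) _ = p

  split-⟦⟧ : ∀ l a b x → (a ≡ true → b ≡ false) → ⟦ l ∧ ((a ∨ b) ∧ x) ⟧ ≡ ⟦ a ∧ (l ∧ x) ⟧ + ⟦ b ∧ (l ∧ x) ⟧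
  split-⟦⟧ l true  b     x h rewrite h refl = sym (ℕ.+-identityʳ _)
  split-⟦⟧ l false true  x h = refl
  split-⟦⟧ l false false x h = cong ⟦_⟧ (Bool.∧-zeroʳ l)

  -- `l` and `l′` compare the two ends of an edge in either order. Exactly one of them is true, so a
  -- directed edge of the cycle counts once.
  merge-⟦⟧ : ∀ l l′ a x x′ → (a ≡ true → l′ ≡ not l) → x′ ≡ x → ⟦ a ∧ (l ∧ x) ⟧ + ⟦ a ∧ (l′ ∧ x′) ⟧ ≡ ⟦ a ∧ x ⟧
  merge-⟦⟧ l     l′ false x x′ h refl = refl
  merge-⟦⟧ true  l′ true  x x′ h refl rewrite h refl = ℕ.+-identityʳ _
  merge-⟦⟧ false l′ true  x x′ h refl rewrite h refl = refl

  module _ {m : ℕ} (3≤ : 3 ≤ suc m) where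

    private
      n = suc m
      N : Fin n → Fin n → Bool
      N u v = does (next? u v)

    -- Every edge of the cycle is traversed once in the direction of Next.
    sum-cycle : (L χ : Fin n → Fin n → Bool) →
      (∀ u v → u ≢ v → L v u ≡ not (L u v)) → (∀ u v → χ u v ≡ χ v u) →
      sum (λ u → sum λ v → ⟦ L u v ∧ ((N u v ∨ N v u) ∧ χ u v) ⟧) ≡ sum (λ u → ⟦ χ u (next u) ⟧)
    sum-cycle L χ L-asym χ-sym = begin
      sum (λ u → sum λ v → ⟦ L u v ∧ ((N u v ∨ N v u) ∧ χ u v) ⟧)
        ≡⟨ sum-cong-≗ (λ u → sum-cong-≗ (split u)) ⟩
      sum (λ u → sum λ v → X u v + Y u v)
        ≡⟨ ∑∑-distrib-+ X Y ⟩
      sum (λ u → sum (X u)) + sum (λ u → sum (Y u))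
        ≡⟨ cong (sum (λ u → sum (X u)) +_) (∑-comm Y) ⟩
      sum (λ u → sum (X u)) + sum (λ u → sum λ v → Y v u)
        ≡⟨ ∑∑-distrib-+ X (λ u v → Y v u) ⟨
      sum (λ u → sum λ v → X u v + Y v u)
        ≡⟨ sum-cong-≗ (λ u → sum-cong-≗ (merge u)) ⟩
      sum (λ u → sum λ v → ⟦ N u v ∧ χ u v ⟧)
        ≡⟨ sum-cong-≗ (λ u → trans (sum-single (λ v → ⟦ N u v ∧ χ u v ⟧) (next u) (λ v v≢ → cong (λ b → ⟦ b ∧ χ u v ⟧)
             (dec-false (next? u v) (λ p → v≢ (Next-unique p (Next-next u))))))
             (cong (λ b → ⟦ b ∧ χ u (next u) ⟧) (dec-true (next? u (next u)) (Next-next u)))) ⟩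
      sum (λ u → ⟦ χ u (next u) ⟧) ∎
      where
      open ≡-Reasoning
      X Y : Fin n → Fin n → ℕ
      X u v = ⟦ N u v ∧ (L u v ∧ χ u v) ⟧
      Y u v = ⟦ N v u ∧ (L u v ∧ χ u v) ⟧
      ∑∑-distrib-+ : (X Y : Fin n → Fin n → ℕ) →
        sum (λ u → sum λ v → X u v + Y u v) ≡ sum (λ u → sum (X u)) + sum (λ u → sum (Y u))
      ∑∑-distrib-+ X Y = trans (sum-cong-≗ (λ u → ∑-distrib-+ (X u) (Y u)))
                               (∑-distrib-+ (λ u → sum (X u)) (λ u → sum (Y u)))
      split : ∀ u v → ⟦ L u v ∧ ((N u v ∨ N v u) ∧ χ u v) ⟧ ≡ X u v + Y u v
      split u v = split-⟦⟧ (L u v) (N u v) (N v u) (χ u v)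
        (λ p → dec-false (next? v u) (Next-asym 3≤ (does⇒ (next? u v) p)))
      merge : ∀ u v → X u v + Y v u ≡ ⟦ N u v ∧ χ u v ⟧
      merge u v = merge-⟦⟧ (L u v) (L v u) (N u v) (χ u v) (χ v u)
        (λ p → L-asym u v λ { refl → ¬Next-refl 3≤ u (does⇒ (next? u u) p) }) (χ-sym v u)

    mono : ∀ {r} → Colouring n r → Fin r → Fin n → Fin n → ℕ
    mono c k u v = ⟦ does (colour c u v Fin.≟ k) ⟧

    -- Both sums are reindexed by the permutation `to`. The order of the vertices then becomes a
    -- tournament on the positions, which is why `sum-cycle` allows any `L` with
    -- `L v u ≡ not (L u v)`.
    edgesOfColour-tour : ∀ {r} (c : Colouring n r) k (G : Graph n) (to : Fin n → Fin n) → Injective _≡_ _≡_ to →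
      (∀ u v → adj (C n 3≤) u v ≡ adj G (to u) (to v)) → edgesOfColour G c k ≡ tour _+_ (mono c k) to
    edgesOfColour-tour c k G to inj adj≡ = begin
      edgesOfColour G c k
        ≡⟨ length-filter-pairs (λ (i , j) → (i Fin.<? j) ×-dec (Bool.T? (adj G i j) ×-dec (colour c i j Fin.≟ k))) id id ⟩
      sum (λ i → sum λ j → X i j)
        ≡⟨ sum-permute (λ i → sum λ j → X i j) π ⟩
      sum (λ u → sum λ j → X (to u) j)
        ≡⟨ sum-cong-≗ (λ u → sum-permute (X (to u)) π) ⟩
      sum (λ u → sum λ v → X (to u) (to v))
        ≡⟨ sum-cong-≗ (λ u → sum-cong-≗ λ v → cong (λ b → ⟦ does (to u Fin.<? to v) ∧ (b ∧ χ u v) ⟧) (sym (adj≡ u v))) ⟩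
      sum (λ u → sum λ v → ⟦ does (to u Fin.<? to v) ∧ ((N u v ∨ N v u) ∧ χ u v) ⟧)
        ≡⟨ sum-cycle (λ u v → does (to u Fin.<? to v)) χ <-flip (λ u v → cong (λ x → does (x Fin.≟ k)) (colour-sym c _ _)) ⟩
      sum (λ u → ⟦ χ u (next u) ⟧)
        ≡⟨ sum-cong-≗ (λ u → cong (mono c k (to u)) (sym (shifted-∘ to id zero u))) ⟩
      sum (λ u → mono c k (to u) (shifted to (to zero) u))
        ≡⟨ sum-shifted (mono c k) to (to zero) ⟩
      tour _+_ (mono c k) to ∎
      where
      open ≡-Reasoning
      π = injective⇒permutation to inj
      X : Fin n → Fin n → ℕ
      X i j = ⟦ does (i Fin.<? j) ∧ (adj G i j ∧ does (colour c i j Fin.≟ k)) ⟧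
      χ : Fin n → Fin n → Bool
      χ u v = does (colour c (to u) (to v) Fin.≟ k)
      <-flip : ∀ u v → u ≢ v → does (to v Fin.<? to u) ≡ not (does (to u Fin.<? to v))
      <-flip u v u≢v with to u Fin.<? to v
      ... | yes p = trans (dec-false (to v Fin.<? to u) (ℕ.<-asym p)) (cong not (sym (dec-true (to u Fin.<? to v) p)))
      ... | no ¬p = trans (dec-true (to v Fin.<? to u) (ℕ.≤∧≢⇒< (ℕ.≮⇒≥ ¬p) (λ eq → u≢v (inj (Fin.toℕ-injective (sym eq))))))
                          (cong not (sym (dec-false (to u Fin.<? to v) ¬p)))

    -- A copy of the cycle matters only through the vertex map of its isomorphism, so subgraphs can
    -- be left behind here.
    OddOnTours : ∀ {r} → Colouring n r → Set
    OddOnTours c = ∀ (to : Fin n → Fin n) → Injective _≡_ _≡_ to → ∃[ k ] Odd (tour _+_ (mono c k) to)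

    cycleAlong : (to : Fin n → Fin n) → Injective _≡_ _≡_ to → Σ (Subgraph (K n)) (C n 3≤ ≅_)
    cycleAlong to inj = record
      { vertices = Subset.⊤
      ; edges = record
        { adj = λ i j → adj (C n 3≤) (from i) (from j)
        ; adj-sym = λ i j → adj-sym (C n 3≤) (from i) (from j)
        ; irrefl = λ i → irrefl (C n 3≤) (from i) }
      ; edges⊆G = loopless
      ; incident = λ _ _ _ → Subset.∈⊤ , Subset.∈⊤ } , record
      { to = to
      ; injective = inj
      ; image = λ i → mk⇔ (λ _ → from i , inverseʳ π) (λ _ → Subset.∈⊤)
      ; adj-≡ = λ u v → sym (cong₂ (adj (C n 3≤)) (inverseˡ π) (inverseˡ π)) }
      where
      π = injective⇒permutation to inj
      from : Fin n → Fin n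
      from = π ⟨$⟩ˡ_
      loopless : ∀ i j → T (adj (C n 3≤) (from i) (from j)) → T (adj (K n) i j)
      loopless i j e with i Fin.≟ j
      ... | no _     = _
      ... | yes refl = subst T (irrefl (C n 3≤) (from i)) e

    odd⇒oddOnTours : ∀ {r} {c : Colouring n r} → IsOddColouring (K n) (C n 3≤) c → OddOnTours c
    odd⇒oddOnTours {c = c} odd to inj with odd (proj₁ (cycleAlong to inj)) (proj₂ (cycleAlong to inj))
    ... | k , o = k , subst Odd (edgesOfColour-tour c k (edges (proj₁ (cycleAlong to inj))) to inj
                                 (_≅_.adj-≡ (proj₂ (cycleAlong to inj)))) o

    oddOnTours⇒odd : ∀ {r} {c : Colouring n r} → OddOnTours c → IsOddColouring (K n) (C n 3≤) c
    oddOnTours⇒odd {c = c} odd S iso with odd (_≅_.to iso) (_≅_.injective iso)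
    ... | k , o = k , subst Odd (sym (edgesOfColour-tour c k (edges S) (_≅_.to iso) (_≅_.injective iso) (_≅_.adj-≡ iso))) o

  -- Even colour counts as vanishing sums in F₂ʳ

  walk-homo : ∀ {A M N : Set} {_∙_ : M → M → M} {_◦_ : N → N → N} (h : M → N) → (∀ x y → h (x ∙ y) ≡ h x ◦ h y) →
              (f : A → A → M) → ∀ u L z → h (walk _∙_ f u L z) ≡ walk _◦_ (λ u v → h (f u v)) u L z
  walk-homo h homo f u []      z = refl
  walk-homo {_◦_ = _◦_} h homo f u (v ∷ L) z = trans (homo _ _) (cong (h (f u v) ◦_) (walk-homo h homo f v L z))

  walk-cong : ∀ {A M : Set} {_∙_ : M → M → M} {f g : A → A → M} → (∀ u v → f u v ≡ g u v) →
              ∀ u L z → walk _∙_ f u L z ≡ walk _∙_ g u L z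
  walk-cong h u []      z = h u z
  walk-cong {_∙_ = _∙_} h u (v ∷ L) z = cong₂ _∙_ (h u v) (walk-cong h v L z)

  walk-++ : ∀ {A : Set} {r} (f : A → A → Vec Bool r) u L v R z →
            walk _⊕_ f u (L ++ v ∷ R) z ≡ walk _⊕_ f u L v ⊕ walk _⊕_ f v R z
  walk-++ f u []      v R z = refl
  walk-++ f u (w ∷ L) v R z = trans (cong (f u w ⊕_) (walk-++ f w L v R z)) (sym (⊕-assoc (f u w) _ _))

  walk-parity : ∀ {A : Set} (b : A → A → Bool) u L z →
                ∃[ j ] walk _+_ (λ u v → ⟦ b u v ⟧) u L z ≡ j * 2 + ⟦ walk _xor_ b u L z ⟧
  walk-parity b u []      z = 0 , refl
  walk-parity b u (v ∷ L) z = let (j , eq) = walk-parity b v L z in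
    step (b u v) (walk _xor_ b v L z) j eq
    where
    step : ∀ x y {s} j → s ≡ j * 2 + ⟦ y ⟧ → ∃[ j′ ] ⟦ x ⟧ + s ≡ j′ * 2 + ⟦ x xor y ⟧
    step false y     j eq = j , eq
    step true  false j eq = j , trans (cong suc eq) (sym (ℕ.+-suc (j * 2) 0))
    step true  true  j eq = suc j , trans (cong suc eq)
      (trans (sym (ℕ.+-suc (j * 2) 1)) (trans (ℕ.+-comm (j * 2) 2) (sym (ℕ.+-identityʳ _))))

  ⟦⟧-even : ∀ j b → 2 ∣ j * 2 + ⟦ b ⟧ → b ≡ false
  ⟦⟧-even j false _ = refl
  ⟦⟧-even j true  p with divides (suc q) () ← ∣m+n∣m⇒∣n p (n∣m*n j)

  lookup-walk : ∀ {A : Set} {r} (c : A → A → Fin r) k u L z →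
                Vec.lookup (walk _⊕_ (λ u v → unit (c u v)) u L z) k ≡ walk _xor_ (λ u v → does (c u v Fin.≟ k)) u L z
  lookup-walk c k u L z = trans
    (walk-homo (λ x → Vec.lookup x k) (λ x y → Vec.lookup-zipWith _xor_ k x y) (λ u v → unit (c u v)) u L z)
    (walk-cong (λ u v → Vec.lookup∘tabulate _ k) u L z)

  balanced⇒even : ∀ {A : Set} {r} (c : A → A → Fin r) u L z → walk _⊕_ (λ u v → unit (c u v)) u L z ≡ 0v →
                  ∀ k → 2 ∣ walk _+_ (λ u v → ⟦ does (c u v Fin.≟ k) ⟧) u L z
  balanced⇒even c u L z eq k =
    let (j , eq′) = walk-parity (λ u v → does (c u v Fin.≟ k)) u L z
    in divides j (trans eq′ (trans (cong (λ b → j * 2 + ⟦ b ⟧)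
         (trans (sym (lookup-walk c k u L z)) (trans (cong (λ x → Vec.lookup x k) eq) (Vec.lookup-replicate k false))))
       (ℕ.+-identityʳ _)))

  even⇒balanced : ∀ {A : Set} {r} (c : A → A → Fin r) u L z →
                  (∀ k → 2 ∣ walk _+_ (λ u v → ⟦ does (c u v Fin.≟ k) ⟧) u L z) →
                  walk _⊕_ (λ u v → unit (c u v)) u L z ≡ 0v
  even⇒balanced c u L z even = begin
    W                              ≡⟨ Vec.tabulate∘lookup W ⟨
    Vec.tabulate (Vec.lookup W)    ≡⟨ Vec.tabulate-cong (λ k → trans (lookup-walk c k u L z)
      (trans (false-at k) (sym (Vec.lookup-replicate k false)))) ⟩
    Vec.tabulate (Vec.lookup 0v)   ≡⟨ Vec.tabulate∘lookup 0v ⟩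
    0v                             ∎
    where
    open ≡-Reasoning
    W = walk _⊕_ (λ u v → unit (c u v)) u L z
    false-at : ∀ k → walk _xor_ (λ u v → does (c u v Fin.≟ k)) u L z ≡ false
    false-at k = let (j , eq) = walk-parity (λ u v → does (c u v Fin.≟ k)) u L z
                 in ⟦⟧-even j _ (subst (2 ∣_) eq (even k))

  unique⇒lookup-injective : ∀ {A : Set} {L : List A} → Unique L → Injective _≡_ _≡_ (lookup L)
  unique⇒lookup-injective {L = x ∷ L} (x∉ ∷ u) {zero}  {zero}  eq = refl
  unique⇒lookup-injective {L = x ∷ L} (x∉ ∷ u) {zero}  {suc j} eq = contradiction eq (All.lookup x∉ (∈-lookup j))
  unique⇒lookup-injective {L = x ∷ L} (x∉ ∷ u) {suc i} {zero}  eq = contradiction (sym eq) (All.lookup x∉ (∈-lookup i))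
  unique⇒lookup-injective {L = x ∷ L} (x∉ ∷ u) {suc i} {suc j} eq = cong suc (unique⇒lookup-injective u eq)

  tabulation : ∀ {A : Set} (L : List A) {m} → m ≡ length L → Unique L →
               ∃[ f ] tabulate {n = m} f ≡ L × Injective _≡_ _≡_ f
  tabulation L refl uniq = lookup L , List.tabulate-lookup L , unique⇒lookup-injective uniq

  lower : ∀ {m r} (3≤ : 3 ≤ suc m) → 2 ∣ suc m → r * r + 24 * r + 4 ≤ suc m → ¬ OddColourable (K (suc m)) (C (suc m) 3≤) r
  lower {m} {r} 3≤ 2∣n big (c , odd) = refute (EvenCycle.balancedCycle (colour c) (colour-sym c) 2∣n big)
    where
    f : Fin (suc m) → Fin (suc m) → Vec Bool r
    f u v = unit (colour c u v)
    Tabulated : List (Fin (suc m)) → Set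
    Tabulated L = ∃[ to ] tabulate {n = suc m} to ≡ L × Injective _≡_ _≡_ to
    unbalanced : ∀ {h t} → walk _⊕_ f h t h ≡ 0v → ¬ Tabulated (h ∷ t)
    unbalanced {h} eq (to , refl , inj) = let (k , odd-k) = odd⇒oddOnTours 3≤ {c = c} odd to inj in
      odd-k (balanced⇒even (colour c) h (tabulate (to ∘ suc)) h eq k)
    refute : ¬ (∃[ h ] ∃[ t ] allFin (suc m) ↭ h ∷ t × walk _⊕_ f h t h ≡ 0v)
    refute (h , t , all↭ , eq) = unbalanced eq
      (tabulation (h ∷ t) (trans (sym (List.length-tabulate {n = suc m} id)) (↭-length all↭))
                  (unique-resp-↭ all↭ (Unique.allFin⁺ (suc m))))

  -- Linear functionals and the hub colouring

  dot : ∀ {r} → Vec Bool r → Vec Bool r → Bool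
  dot []      []      = false
  dot (a ∷ φ) (b ∷ x) = (a ∧ b) xor dot φ x

  dot-⊕ : ∀ {r} (φ x y : Vec Bool r) → dot φ (x ⊕ y) ≡ dot φ x xor dot φ y
  dot-⊕ []      []      []      = refl
  dot-⊕ (a ∷ φ) (b ∷ x) (c ∷ y) = trans (cong ((a ∧ (b xor c)) xor_) (dot-⊕ φ x y))
    (B.solve 5 (λ a b c s t → a B.:* (b B.:+ c) B.:+ (s B.:+ t) B.:= (a B.:* b B.:+ s) B.:+ (a B.:* c B.:+ t))
      refl a b c (dot φ x) (dot φ y))

  dot-0 : ∀ {r} (φ : Vec Bool r) → dot φ 0v ≡ false
  dot-0 []      = refl
  dot-0 (a ∷ φ) = cong₂ _xor_ (Bool.∧-zeroʳ a) (dot-0 φ)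

  dot-unit : ∀ {r} (φ : Vec Bool r) k → dot φ (unit k) ≡ Vec.lookup φ k
  dot-unit (a ∷ φ) zero = trans (cong₂ _xor_ (Bool.∧-identityʳ a)
    (trans (cong (dot φ) (zeros _)) (dot-0 φ))) (Bool.xor-identityʳ a)
    where
    zeros : ∀ n → Vec.tabulate {n = n} (λ _ → false) ≡ 0v
    zeros zero    = refl
    zeros (suc n) = cong (false ∷_) (zeros n)
  dot-unit (a ∷ φ) (suc k) = trans (cong (_xor dot φ (unit k)) (Bool.∧-zeroʳ a)) (dot-unit φ k)

  -- A Boolean function on the colours extends to a linear functional on F₂ʳ, which sends the zero
  -- sum to zero.
  walk-functional : ∀ {A : Set} {r} (c : A → A → Fin r) u L z → walk _⊕_ (λ u v → unit (c u v)) u L z ≡ 0v →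
                    (φ : Fin r → Bool) → walk _xor_ (λ u v → φ (c u v)) u L z ≡ false
  walk-functional c u L z eq φ = begin
    walk _xor_ (λ u v → φ (c u v)) u L z
      ≡⟨ walk-cong (λ u v → trans (dot-unit φᵥ (c u v)) (Vec.lookup∘tabulate φ (c u v))) u L z ⟨
    walk _xor_ (λ u v → dot φᵥ (unit (c u v))) u L z
      ≡⟨ walk-homo (dot φᵥ) (dot-⊕ φᵥ) (λ u v → unit (c u v)) u L z ⟨
    dot φᵥ (walk _⊕_ (λ u v → unit (c u v)) u L z)
      ≡⟨ cong (dot φᵥ) eq ⟩
    dot φᵥ 0v
      ≡⟨ dot-0 φᵥ ⟩
    false ∎
    where
    open ≡-Reasoning
    φᵥ = Vec.tabulate φ

  -- Colours must be elements of a `Fin`, so F₂ᵇ is carried by `Fin (2 ^ b)` and addressed through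
  -- binary digits.
  bit : ∀ {b} → Fin (2 ^ b) → Fin b → Bool
  bit a i = does (Fin.finToFun a i Fin.≟ suc zero)

  fromBits : ∀ {b} → (Fin b → Bool) → Fin (2 ^ b)
  fromBits h = Fin.funToFin (λ i → if h i then suc zero else zero)

  bit-fromBits : ∀ {b} (h : Fin b → Bool) i → bit (fromBits h) i ≡ h i
  bit-fromBits h i rewrite Fin.finToFun-funToFin (λ i → if h i then suc (zero {0}) else zero) i with h i
  ... | true  = refl
  ... | false = refl

  fromBits-cong : ∀ {b} {h h′ : Fin b → Bool} → (∀ i → h i ≡ h′ i) → fromBits h ≡ fromBits h′
  fromBits-cong eq = funToFin-cong (λ i → cong (λ b → if b then suc zero else zero) (eq i))

  bit-injective : ∀ {b} (x y : Fin (2 ^ b)) → (∀ i → bit x i ≡ bit y i) → x ≡ y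
  bit-injective {b} x y eq = trans (sym (Fin.funToFin-finToFin {b} x))
    (trans (funToFin-cong {b} (λ i → digit (Fin.finToFun x i) (Fin.finToFun y i) (eq i))) (Fin.funToFin-finToFin {b} y))
    where
    digit : (p q : Fin 2) → does (p Fin.≟ suc zero) ≡ does (q Fin.≟ suc zero) → p ≡ q
    digit zero       zero       _ = refl
    digit zero       (suc zero) ()
    digit (suc zero) zero       ()
    digit (suc zero) (suc zero) _ = refl

  nonzero⇒map-suc : ∀ {m} (L : List (Fin (suc m))) → All (zero ≢_) L → ∃[ R ] L ≡ map suc R
  nonzero⇒map-suc []          []        = [] , refl
  nonzero⇒map-suc (zero ∷ L)  (p ∷ ps)  = contradiction refl p
  nonzero⇒map-suc (suc w ∷ L) (p ∷ ps)  = let (R , eq) = nonzero⇒map-suc L ps in w ∷ R , cong (suc w ∷_) eq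

  lastOr : ∀ {A : Set} → A → List A → A
  lastOr w []      = w
  lastOr w (v ∷ R) = lastOr v R

  lastOr-∈ : ∀ {A : Set} (w v : A) R → lastOr w (v ∷ R) ∈ v ∷ R
  lastOr-∈ w v []      = here refl
  lastOr-∈ w v (u ∷ R) = there (lastOr-∈ v u R)

  -- The hub is the vertex zero.
  module Construction {m b j : ℕ} (3≤ : 3 ≤ suc m) (m≤ : m ≤ 2 ^ b * suc j) where

    g : Fin m → Fin (2 ^ b)
    g w = proj₁ (Fin.remQuot {2 ^ b} (suc j) (Fin.inject≤ w m≤))

    h : Fin m → Fin (suc j)
    h w = proj₂ (Fin.remQuot {2 ^ b} (suc j) (Fin.inject≤ w m≤))

    label-injective : ∀ {w w′} → g w ≡ g w′ → h w ≡ h w′ → w ≡ w′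
    label-injective {w} {w′} g≡ h≡ = Fin.inject≤-injective m≤ m≤ w w′
      (trans (sym (Fin.combine-remQuot {2 ^ b} (suc j) _)) (trans (cong₂ Fin.combine g≡ h≡) (Fin.combine-remQuot {2 ^ b} (suc j) _)))

    -- The label 0 needs no colour of its own, as the absence of the `j` others identifies it. As
    -- the zero of the group it is invisible to every `rimBit`.
    spokeLabel : Fin (suc j) → Fin (2 ^ b + j)
    spokeLabel zero    = fromBits {b} (λ _ → false) ↑ˡ j
    spokeLabel (suc q) = 2 ^ b ↑ʳ q

    spoke : Fin m → Fin (2 ^ b + j)
    spoke w = spokeLabel (h w)

    rim : Fin m → Fin m → Fin (2 ^ b + j)
    rim w w′ = fromBits {b} (λ i → bit (g w) i xor bit (g w′) i) ↑ˡ j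

    col : Fin (suc m) → Fin (suc m) → Fin (2 ^ b + j)
    col zero    zero     = fromBits {b} (λ _ → false) ↑ˡ j
    col zero    (suc w)  = spoke w
    col (suc w) zero     = spoke w
    col (suc w) (suc w′) = rim w w′

    col-sym : ∀ u v → col u v ≡ col v u
    col-sym zero    zero     = refl
    col-sym zero    (suc w)  = refl
    col-sym (suc w) zero     = refl
    col-sym (suc w) (suc w′) = cong (_↑ˡ j) (fromBits-cong {b} (λ i → Bool.xor-comm (bit (g w) i) (bit (g w′) i)))

    colouring : Colouring (suc m) (2 ^ b + j)
    colouring = record { colour = col ; colour-sym = col-sym }

    module _ (φ : Fin (2 ^ b + j) → Bool) (G : Fin m → Bool) (φ-rim : ∀ w w′ → φ (rim w w′) ≡ G w xor G w′) where

      -- An inner vertex of the path lies on two rim edges, so its `G` cancels; only the two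
      -- neighbours of the hub remain.
      walk-telescopes : ∀ w R → walk _xor_ (λ u v → φ (col u v)) (suc w) (map suc R) zero ≡
                                G w xor (G (lastOr w R) xor φ (spoke (lastOr w R)))
      walk-telescopes w []      = B.solve 2 (λ a s → s B.:= a B.:+ (a B.:+ s)) refl (G w) (φ (spoke w))
      walk-telescopes w (v ∷ R) = trans (cong₂ _xor_ (φ-rim w v) (walk-telescopes v R))
        (B.solve 3 (λ a b s → (a B.:+ b) B.:+ (b B.:+ s) B.:= a B.:+ s) refl (G w) (G v) _)

      spokes-agree : ∀ w R → walk _⊕_ (λ u v → unit (col u v)) zero (map suc (w ∷ R)) zero ≡ 0v →
                     φ (spoke w) xor G w ≡ φ (spoke (lastOr w R)) xor G (lastOr w R)
      spokes-agree w R eq = xor≡false⇒≡ (trans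
        (B.solve 4 (λ s a t c → (s B.:+ a) B.:+ (t B.:+ c) B.:= s B.:+ (a B.:+ (c B.:+ t)))
          refl (φ (spoke w)) (G w) (φ (spoke (lastOr w R))) (G (lastOr w R)))
        (trans (cong (φ (spoke w) xor_) (sym (walk-telescopes w R))) (walk-functional col zero (map suc (w ∷ R)) zero eq φ)))
        where
        xor≡false⇒≡ : ∀ {x y} → x xor y ≡ false → x ≡ y
        xor≡false⇒≡ {false} {false} _ = refl
        xor≡false⇒≡ {true}  {true}  _ = refl

    rimBit : Fin b → Fin (2 ^ b + j) → Bool
    rimBit i x = [ (λ a → bit {b} a i) , const false ] (Fin.splitAt (2 ^ b) x)

    rimBit-rim : ∀ i w w′ → rimBit i (rim w w′) ≡ bit (g w) i xor bit (g w′) i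
    rimBit-rim i w w′ = trans (cong [ (λ a → bit {b} a i) , const false ] (Fin.splitAt-↑ˡ (2 ^ b) _ j))
      (bit-fromBits (λ i → bit (g w) i xor bit (g w′) i) i)

    rimBit-spoke : ∀ i x → rimBit i (spokeLabel x) ≡ false
    rimBit-spoke i zero    = trans (cong [ (λ a → bit {b} a i) , const false ] (Fin.splitAt-↑ˡ (2 ^ b) _ j))
      (bit-fromBits {b} (λ _ → false) i)
    rimBit-spoke i (suc q) = cong [ (λ a → bit {b} a i) , const false ] (Fin.splitAt-↑ʳ (2 ^ b) j q)

    isNew : Fin j → Fin (2 ^ b + j) → Bool
    isNew q x = [ const false , (λ q′ → does (q′ Fin.≟ q)) ] (Fin.splitAt (2 ^ b) x)

    isNew-rim : ∀ q w w′ → isNew q (rim w w′) ≡ false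
    isNew-rim q w w′ = cong [ const false , (λ q′ → does (q′ Fin.≟ q)) ] (Fin.splitAt-↑ˡ (2 ^ b) _ j)

    isNew-spoke : ∀ q x → isNew q (spokeLabel x) ≡ does (x Fin.≟ suc q)
    isNew-spoke q zero     = cong [ const false , (λ q′ → does (q′ Fin.≟ q)) ] (Fin.splitAt-↑ˡ (2 ^ b) _ j)
    isNew-spoke q (suc q′) = cong [ const false , (λ q′ → does (q′ Fin.≟ q)) ] (Fin.splitAt-↑ʳ (2 ^ b) j q′)

    -- Two kinds of functionals suffice: `rimBit i` vanishes on all spokes and detects a bit of `g`,
    -- while `isNew q` vanishes on the rim and detects `h`.
    spokes-same : ∀ w R → walk _⊕_ (λ u v → unit (col u v)) zero (map suc (w ∷ R)) zero ≡ 0v → w ≡ lastOr w R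
    spokes-same w R eq = label-injective
      (bit-injective {b} _ _ λ i → subst₂ _≡_ (cong (_xor bit (g w) i) (rimBit-spoke i (h w)))
        (cong (_xor bit (g (lastOr w R)) i) (rimBit-spoke i (h (lastOr w R))))
        (spokes-agree (rimBit i) (λ w → bit (g w) i) (rimBit-rim i) w R eq))
      (same-h (h w) (h (lastOr w R)) λ q → subst₂ _≡_
        (trans (Bool.xor-identityʳ _) (isNew-spoke q (h w)))
        (trans (Bool.xor-identityʳ _) (isNew-spoke q (h (lastOr w R))))
        (spokes-agree (isNew q) (λ _ → false) (isNew-rim q) w R eq))
      where
      same-h : ∀ x y → (∀ q → does (x Fin.≟ suc q) ≡ does (y Fin.≟ suc q)) → x ≡ y
      same-h zero    zero    _  = refl
      same-h zero    (suc q) eq = contradiction (trans (eq q) (dec-true (suc q Fin.≟ suc q) refl)) λ ()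
      same-h (suc q) y       eq = sym (does⇒ (y Fin.≟ suc q) (trans (sym (eq q)) (dec-true (suc q Fin.≟ suc q) refl)))

    -- The closed walk is cut at its start and at the hub, and the two parts are interchanged.
    rotated : ∀ t z → (∃[ A ] ∃[ B ] z ∷ t ≡ A ++ zero ∷ B) → Unique (z ∷ t) →
              walk _⊕_ (λ u v → unit (col u v)) z t z ≡ 0v →
              ∃[ L ] zero ∷ L ↭ z ∷ t × walk _⊕_ (λ u v → unit (col u v)) zero L zero ≡ 0v
    rotated t z ([]    , B , refl) uniq eq = t , ↭-refl , eq
    rotated t z (_ ∷ A , B , refl) uniq eq = B ++ z ∷ A , ++-comm (zero ∷ B) (z ∷ A) ,
      trans (walk-++ _ zero B z A zero) (trans (⊕-comm _ _) (trans (sym (walk-++ _ z A zero B z)) eq))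

    -- On a cycle with at least three vertices the hub has two distinct neighbours, against
    -- `spokes-same`.
    unbalanced : ∀ R → 3 ≤ suc (length (map (Fin.suc {m}) R)) → Unique (map (Fin.suc {m}) R) →
                 walk _⊕_ (λ u v → unit (col u v)) zero (map suc R) zero ≢ 0v
    unbalanced []           (s≤s ())
    unbalanced (w ∷ [])     (s≤s (s≤s ()))
    unbalanced (w ∷ v ∷ R) _ uniq eq = All.lookup (AllPairs.head (Unique.map⁻ uniq)) (lastOr-∈ w v R) (spokes-same w (v ∷ R) eq)

    oddOnTours : OddOnTours 3≤ colouring
    -- An odd colour can be searched for, so it is enough to refute that all colours are even.
    oddOnTours to inj = decidable-stable (Fin.any? λ k → ¬? (even? k)) λ none →
      refute (rotated t z (split (injective⇒surjective to inj zero)) uniq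
        (even⇒balanced col z t z (λ k → decidable-stable (even? k) (λ o → none (k , o)))))
      where
      z = to zero
      t = tabulate (to ∘ suc)
      even? : ∀ k → Dec (2 ∣ walk _+_ (λ u v → ⟦ does (col u v Fin.≟ k) ⟧) z t z)
      even? k = 2 ∣? walk _+_ (λ u v → ⟦ does (col u v Fin.≟ k) ⟧) z t z
      uniq : Unique (z ∷ t)
      uniq = Unique.tabulate⁺ inj
      split : (∃[ i ] to i ≡ zero) → ∃[ A ] ∃[ B ] z ∷ t ≡ A ++ zero ∷ B
      split (i , eq) = ∈-∃++ (subst (_∈ z ∷ t) eq (∈-tabulate⁺ {f = to} i))
      refute : ¬ (∃[ L ] zero ∷ L ↭ z ∷ t × walk _⊕_ (λ u v → unit (col u v)) zero L zero ≡ 0v)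
      refute (L , L↭ , eq) = go (nonzero⇒map-suc L (AllPairs.head uniq′)) 3≤L (AllPairs.tail uniq′) eq
        where
        uniq′ : Unique (zero ∷ L)
        uniq′ = unique-resp-↭ (↭-sym L↭) uniq
        3≤L : 3 ≤ suc (length L)
        3≤L = subst (3 ≤_) (sym (trans (↭-length L↭) (List.length-tabulate to))) 3≤
        go : ∀ {L} → (∃[ R ] L ≡ map suc R) → 3 ≤ suc (length L) → Unique L →
             walk _⊕_ (λ u v → unit (col u v)) zero L zero ≢ 0v
        go (R , refl) = unbalanced R

    odd : OddColourable (K (suc m)) (C (suc m) 3≤) (2 ^ b + j)
    odd = colouring , oddOnTours⇒odd 3≤ {c = colouring} oddOnTours

  -- Existence of the odd-Ramsey number

  module _ {m r : ℕ} where

    private n = suc m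

    OddFun : (Fin n → Fin n → Fin r) → Set
    OddFun col = ∀ (to : Fin n → Fin n) → Injective _≡_ _≡_ to →
                 ∃[ k ] Odd (tour _+_ (λ u v → ⟦ does (col u v Fin.≟ k) ⟧) to)

    oddFun-resp : ∀ {col col′} → (∀ u v → col u v ≡ col′ u v) → OddFun col → OddFun col′
    oddFun-resp eq odd to inj = let (k , o) = odd to inj in
      k , subst Odd (walk-cong (λ u v → cong (λ x → ⟦ does (x Fin.≟ k) ⟧) (eq u v)) (to zero) (tabulate (to ∘ suc)) (to zero)) o

    tour-cong : ∀ {M : Set} (_∙_ : M → M → M) (g : Fin n → Fin n → M) {to to′ : Fin n → Fin n} →
                to ≗ to′ → tour _∙_ g to ≡ tour _∙_ g to′
    tour-cong _∙_ g {to} {to′} eq =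
      cong₂ (λ x L → walk _∙_ g x L x) (eq zero) (List.tabulate-cong (eq ∘ suc))

    injective? : (f : Fin n → Fin n) → Dec (∀ i j → f i ≡ f j → i ≡ j)
    injective? f = Fin.all? λ i → Fin.all? λ j → (f i Fin.≟ f j) →-dec (i Fin.≟ j)

    -- Vertex maps are searched through their codes in `Fin (n ^ n)`. A map and its decoded code
    -- agree only pointwise, hence the need for `tour-cong`, and for `oddFun-resp` when colourings
    -- are coded.
    oddFun? : ∀ col → Dec (OddFun col)
    oddFun? col = map′ decode encode (Fin.all? λ x →
      injective? (Fin.finToFun {n} {n} x) →-dec Fin.any? λ k → ¬? (2 ∣? tour _+_ (χ k) (Fin.finToFun {n} {n} x)))
      where
      χ : Fin r → Fin n → Fin n → ℕ
      χ k u v = ⟦ does (col u v Fin.≟ k) ⟧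
      OddOnCode : Set
      OddOnCode = ∀ x → (∀ i j → Fin.finToFun {n} {n} x i ≡ Fin.finToFun x j → i ≡ j) →
                  ∃[ k ] Odd (tour _+_ (χ k) (Fin.finToFun {n} {n} x))
      encode : OddFun col → OddOnCode
      encode odd x inj = odd (Fin.finToFun x) (inj _ _)
      decode : OddOnCode → OddFun col
      decode odd to inj =
        let code≗ = Fin.finToFun-funToFin to
            (k , o) = odd (Fin.funToFin to) (λ i j eq → inj (trans (sym (code≗ i)) (trans eq (code≗ j))))
        in k , subst Odd (tour-cong _+_ (χ k) code≗) o

    -- Constructively, `least` can find a minimum only of a decidable property; here both colourings
    -- and tours are finite in number.
    oddColourable? : (3≤ : 3 ≤ n) → Dec (OddColourable (K n) (C n 3≤) r)
    oddColourable? 3≤ = map′ decode encode (Fin.any? λ x →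
        (Fin.all? λ i → Fin.all? λ j → col x i j Fin.≟ col x j i) ×-dec oddFun? (col x))
      where
      col : Fin ((r ^ n) ^ n) → Fin n → Fin n → Fin r
      col x i j = Fin.finToFun {r} {n} (Fin.finToFun {r ^ n} {n} x i) j
      OddCode : Set
      OddCode = ∃[ x ] (∀ i j → col x i j ≡ col x j i) × OddFun (col x)
      decode : OddCode → OddColourable (K n) (C n 3≤) r
      decode (x , col-sym , odd) = let c = record { colour = col x ; colour-sym = col-sym } in c , oddOnTours⇒odd 3≤ {c = c} odd
      encode : OddColourable (K n) (C n 3≤) r → OddCode
      encode (c , odd) = code ,
        (λ i j → trans (sym (col≡ i j)) (trans (colour-sym c i j) (col≡ j i))) ,
        oddFun-resp col≡ (odd⇒oddOnTours 3≤ {c = c} odd)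
        where
        code = Fin.funToFin (λ i → Fin.funToFin (colour c i))
        col≡ : ∀ i j → colour c i j ≡ col code i j
        col≡ i j = sym (trans (cong (λ y → Fin.finToFun y j) (Fin.finToFun-funToFin (λ i → Fin.funToFin (colour c i)) i))
                              (Fin.finToFun-funToFin (colour c i) j))

  least : ∀ {P : ℕ → Set} → (∀ s → Dec (P s)) → ∀ {r} → 1 ≤ r → P r →
          ∃[ s ] 1 ≤ s × P s × s ≤ r × (∀ t → 1 ≤ t → P t → s ≤ t)
  least {P} P? {suc r} _ Pr = scan r 1 refl (s≤s z≤n) λ t → λ where (s≤s z≤n) (s≤s ())
    where
    scan : ∀ d a → a + d ≡ suc r → 1 ≤ a → (∀ t → 1 ≤ t → t < a → ¬ P t) →
           ∃[ s ] 1 ≤ s × P s × s ≤ suc r × (∀ t → 1 ≤ t → P t → s ≤ t)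
    scan d a eq 1≤a none with P? a
    ... | yes Pa = a , 1≤a , Pa , subst (a ≤_) eq (ℕ.m≤m+n a d) ,
                   λ t 1≤t Pt → ℕ.≮⇒≥ λ t<a → none t 1≤t t<a Pt
    scan zero    a eq 1≤a none | no ¬Pa = contradiction (subst P (sym (trans (sym (ℕ.+-identityʳ a)) eq)) Pr) ¬Pa
    scan (suc d) a eq 1≤a none | no ¬Pa = scan d (suc a) (trans (sym (ℕ.+-suc a d)) eq) (s≤s z≤n) none′
      where
      none′ : ∀ t → 1 ≤ t → t < suc a → ¬ P t
      none′ t 1≤t (s≤s t≤a) Pt with ℕ.m≤n⇒m<n∨m≡n t≤a
      ... | inj₁ t<a  = none t 1≤t t<a Pt
      ... | inj₂ refl = ¬Pa Pt

  -- Choice of the group order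

  power-of-4 : ∀ M → 1 ≤ M → ∃[ e ] 2 ^ e * 2 ^ e ≤ M × M < 4 * (2 ^ e * 2 ^ e)
  power-of-4 (suc zero)    _ = 0 , s≤s z≤n , s≤s (s≤s z≤n)
  power-of-4 (suc (suc M)) _ with power-of-4 (suc M) (s≤s z≤n)
  ... | e , lo , hi with suc (suc M) ℕ.<? 4 * (2 ^ e * 2 ^ e)
  ... | yes hi′ = e , ℕ.m≤n⇒m≤1+n lo , hi′
  ... | no ¬hi′ = suc e , subst (_≤ suc (suc M)) double (ℕ.≮⇒≥ ¬hi′) ,
        ℕ.≤-<-trans hi (subst (_< 4 * (2 ^ suc e * 2 ^ suc e)) (sym double)
          (ℕ.m<m+n (2 ^ suc e * 2 ^ suc e)
            (ℕ.≤-trans (ℕ.≤-trans (s≤s z≤n) (ℕ.*-mono-≤ (ℕ.m^n>0 2 (suc e)) (ℕ.m^n>0 2 (suc e)))) (ℕ.m≤m+n _ _))))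
    where
    open +-*-Solver
    double : 4 * (2 ^ e * 2 ^ e) ≡ 2 ^ suc e * 2 ^ suc e
    double = solve 1 (λ k → con 4 :* (k :* k) := (con 2 :* k) :* (con 2 :* k)) refl (2 ^ e)

  -- (j − x) (4 x − j) ≥ 0, with both sides moved so that no subtraction occurs.
  rectangle-≤ : ∀ {x j} → x ≤ j → j ≤ 4 * x → 2 * ((2 * x + j) * (2 * x + j)) ≤ 9 * (j * (2 * x))
  rectangle-≤ {x} x≤j j≤4x with ℕ.m≤n⇒∃[o]m+o≡n x≤j
  ... | s , refl = ℕ.+-cancelʳ-≤ (2 * (s * (x + s))) _ _ (begin
      2 * ((2 * x + (x + s)) * (2 * x + (x + s))) + 2 * (s * (x + s))
        ≤⟨ ℕ.+-monoʳ-≤ (2 * ((2 * x + (x + s)) * (2 * x + (x + s))))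
             (ℕ.*-monoʳ-≤ 2 (ℕ.*-monoʳ-≤ s j≤4x)) ⟩
      2 * ((2 * x + (x + s)) * (2 * x + (x + s))) + 2 * (s * (4 * x))
        ≡⟨ solve 2 (λ x s →
        con 2 :* ((con 2 :* x :+ (x :+ s)) :* (con 2 :* x :+ (x :+ s))) :+ con 2 :* (s :* (con 4 :* x))
        := con 9 :* ((x :+ s) :* (con 2 :* x)) :+ con 2 :* (s :* (x :+ s))) refl x s ⟩
      9 * ((x + s) * (2 * x)) + 2 * (s * (x + s)) ∎)
    where
    open ℕ.≤-Reasoning
    open +-*-Solver

  -- Write k for `2 ^ b` and let j be the quotient of N by k. Then k² ≤ 2N < 4k² gives k/2 ≤ j ≤ 2k,
  -- where 2 (k + j)² ≤ 9 k j ≤ 9 N. Rounding down keeps k j ≤ N, and k (j + 1) > N leaves room for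
  -- N + 1 labels.
  balanced-rectangle : ∀ N → 2 ≤ N → ∃[ b ] ∃[ j ] suc N ≤ 2 ^ b * suc j × 2 * ((2 ^ b + j) * (2 ^ b + j)) ≤ 9 * N
  balanced-rectangle N 2≤N with power-of-4 (2 * N) (ℕ.≤-trans (s≤s z≤n) (ℕ.*-monoʳ-≤ 2 2≤N))
  -- k = 1 is impossible for N ≥ 2, so k is even and k/2 is an integer below.
  ... | zero , _ , hi = contradiction (ℕ.*-monoʳ-≤ 2 2≤N) (ℕ.<⇒≱ hi)
  ... | suc e , lo , hi = suc e , j , subst (suc N ≤_) (ℕ.*-comm (suc j) k) N< , bound
    where
    open +-*-Solver
    k₀ = 2 ^ e
    k = 2 * k₀
    instance
      k≢0 : ℕ.NonZero k
      k≢0 = ℕ.m^n≢0 2 (suc e)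
    j = N / k
    N< : N < suc j * k
    N< = subst (_< suc j * k) (sym (m≡m%n+[m/n]*n N k)) (ℕ.+-monoˡ-< (j * k) (m%n<n N k))
    2k₀²≤N : k₀ * k ≤ N
    2k₀²≤N = ℕ.*-cancelˡ-≤ 2 (subst (_≤ 2 * N) (ℕ.*-assoc 2 k₀ k) lo)
    N<8k₀² : N < 4 * k₀ * k
    N<8k₀² = ℕ.*-cancelˡ-< 2 N (4 * k₀ * k) (subst (2 * N <_)
      (solve 1 (λ x → con 4 :* ((con 2 :* x) :* (con 2 :* x)) := con 2 :* (con 4 :* x :* (con 2 :* x))) refl k₀) hi)
    k₀≤j : k₀ ≤ j
    k₀≤j = ℕ.≤-pred (ℕ.*-cancelʳ-< k k₀ (suc j) (ℕ.≤-<-trans 2k₀²≤N N<))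
    j≤4k₀ : j ≤ 4 * k₀
    j≤4k₀ = ℕ.<⇒≤ (ℕ.*-cancelʳ-< k j (4 * k₀) (ℕ.≤-<-trans (m/n*n≤m N k) N<8k₀²))
    bound : 2 * ((k + j) * (k + j)) ≤ 9 * N
    bound = ℕ.≤-trans (rectangle-≤ k₀≤j j≤4k₀) (ℕ.*-monoʳ-≤ 9 (m/n*n≤m N k))

open Combinatorics using (module Construction; lower; least; oddColourable?; balanced-rectangle)
open import Defs
open import Data.Product using (Σ; _×_)
open import Data.Nat using (ℕ)
open import Data.Integer using (+_)
open import Data.Rational using (_/_)

-- From integer inequalities to real ones

toℚᵘ-/ : ∀ a k → ℚ.toℚᵘ (+ a / suc k) ℚᵘ.≃ ℚᵘ.mkℚᵘ (+ a) k
toℚᵘ-/ a k = ℚ.toℚᵘ-fromℚᵘ (ℚᵘ.mkℚᵘ (+ a) k)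

/-mono : ∀ a b j k → a ℕ.* suc k ℕ.≤ b ℕ.* suc j → + a / suc j ℚ.≤ + b / suc k
/-mono a b j k le = ℚ.toℚᵘ-cancel-≤ (begin
  ℚ.toℚᵘ (+ a / suc j)  ≃⟨ toℚᵘ-/ a j ⟩
  ℚᵘ.mkℚᵘ (+ a) j       ≤⟨ ℚᵘ.*≤* (subst₂ ℤ._≤_ (ℤ.pos-* a (suc k)) (ℤ.pos-* b (suc j)) (ℤ.+≤+ le)) ⟩
  ℚᵘ.mkℚᵘ (+ b) k       ≃⟨ toℚᵘ-/ b k ⟨
  ℚ.toℚᵘ (+ b / suc k)  ∎)
  where open ℚᵘ.≤-Reasoning

/-* : ∀ a b j k → + (a ℕ.* b) / (suc j ℕ.* suc k) ≡ (+ a / suc j) ℚ.* (+ b / suc k)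
/-* a b j k = ℚ.toℚᵘ-injective (begin
  ℚ.toℚᵘ (+ (a ℕ.* b) / (suc j ℕ.* suc k))      ≈⟨ toℚᵘ-/ (a ℕ.* b) (k ℕ.+ j ℕ.* suc k) ⟩
  ℚᵘ.mkℚᵘ (+ (a ℕ.* b)) (k ℕ.+ j ℕ.* suc k)     ≈⟨ ℚᵘ.*≡* (cong (ℤ._* (+ (suc j ℕ.* suc k))) (ℤ.pos-* a b)) ⟩
  ℚᵘ.mkℚᵘ (+ a) j ℚᵘ.* ℚᵘ.mkℚᵘ (+ b) k          ≈⟨ ℚᵘ.*-cong (toℚᵘ-/ a j) (toℚᵘ-/ b k) ⟨
  ℚ.toℚᵘ (+ a / suc j) ℚᵘ.* ℚ.toℚᵘ (+ b / suc k) ≈⟨ ℚ.toℚᵘ-homo-* (+ a / suc j) (+ b / suc k) ⟨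
  ℚ.toℚᵘ ((+ a / suc j) ℚ.* (+ b / suc k))      ∎)
  where open SetoidReasoning ℚᵘ.≃-setoid

/-+ : ∀ a b k → + (a ℕ.+ b) / suc k ≡ + a / suc k ℚ.+ + b / suc k
/-+ a b k = ℚ.toℚᵘ-injective (begin
  ℚ.toℚᵘ (+ (a ℕ.+ b) / suc k)                   ≈⟨ toℚᵘ-/ (a ℕ.+ b) k ⟩
  ℚᵘ.mkℚᵘ (+ (a ℕ.+ b)) k                        ≈⟨ ℚᵘ.*≡* cross ⟩
  ℚᵘ.mkℚᵘ (+ a) k ℚᵘ.+ ℚᵘ.mkℚᵘ (+ b) k           ≈⟨ ℚᵘ.+-cong (toℚᵘ-/ a k) (toℚᵘ-/ b k) ⟨
  ℚ.toℚᵘ (+ a / suc k) ℚᵘ.+ ℚ.toℚᵘ (+ b / suc k) ≈⟨ ℚ.toℚᵘ-homo-+ (+ a / suc k) (+ b / suc k) ⟨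
  ℚ.toℚᵘ (+ a / suc k ℚ.+ + b / suc k)           ∎)
  where
  open SetoidReasoning ℚᵘ.≃-setoid
  cross : + (a ℕ.+ b) ℤ.* (+ suc k ℤ.* + suc k) ≡ (+ a ℤ.* + suc k ℤ.+ + b ℤ.* + suc k) ℤ.* + suc k
  cross = trans (cong (ℤ._* (+ suc k ℤ.* + suc k)) (ℤ.pos-+ a b))
    (trans (sym (ℤ.*-assoc (+ a ℤ.+ + b) (+ suc k) (+ suc k)))
           (cong (ℤ._* + suc k) (ℤ.*-distribʳ-+ (+ suc k) (+ a) (+ b))))

archimedean : ∀ b ε → 0ℚ ℚ.< ε → ∃[ N ] ∀ k → N ℕ.≤ k → + b / suc k ℚ.≤ ε
archimedean b (mkℚ (ℤ.-[1+ _ ]) _ _) (ℚ.*<* ())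
archimedean b (mkℚ (+ 0) _ _) (ℚ.*<* (ℤ.+<+ ()))
archimedean b ε@(mkℚ +[1+ p ] d _) _ = b ℕ.* suc d , λ k N≤k →
  subst (+ b / suc k ℚ.≤_) (ℚ.↥p/↧p≡p ε)
    (/-mono b (suc p) k d (ℕ.≤-trans N≤k (ℕ.≤-trans (ℕ.n≤1+n k) (ℕ.m≤m+n (suc k) (p ℕ.* suc k)))))

p≤p+ε : ∀ p {ε} → 0ℚ ℚ.< ε → p ℚ.≤ p ℚ.+ ε
p≤p+ε p {ε} 0<ε = subst (ℚ._≤ p ℚ.+ ε) (ℚ.+-identityʳ p) (ℚ.+-monoʳ-≤ p (ℚ.<⇒≤ 0<ε))

square-cancel-≤ : ∀ a b → a ℕ.* a ℕ.≤ b ℕ.* b → a ℕ.≤ b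
square-cancel-≤ a b h = ℕ.≮⇒≥ λ b<a → ℕ.<⇒≱ (ℕ.*-mono-< b<a b<a) h

module _ (n r : ℕ) where

  open +-*-Solver

  private
    a b : ℕ → ℕ
    a k = isqrt (2 ℕ.* (suc k ℕ.* suc k))
    b k = isqrt (n ℕ.* (suc k ℕ.* suc k))

    m√ : ∀ m k → isqrt (m ℕ.* (suc k ℕ.* suc k)) ℕ.≤ m ℕ.* suc k
    m√ m k = square-cancel-≤ (isqrt (m ℕ.* (suc k ℕ.* suc k))) (m ℕ.* suc k) (begin
      x ℕ.* x                          ≤⟨ isqrt-lower (m ℕ.* (suc k ℕ.* suc k)) ⟩
      m ℕ.* (suc k ℕ.* suc k)          ≤⟨ m≤m² m ⟩
      (m ℕ.* suc k) ℕ.* (m ℕ.* suc k)  ∎)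
      where
      open ℕ.≤-Reasoning
      x = isqrt (m ℕ.* (suc k ℕ.* suc k))
      m≤m² : ∀ m → m ℕ.* (suc k ℕ.* suc k) ℕ.≤ (m ℕ.* suc k) ℕ.* (m ℕ.* suc k)
      m≤m² zero    = z≤n
      m≤m² (suc m) = subst (suc m ℕ.* (suc k ℕ.* suc k) ℕ.≤_)
        (solve 2 (λ m k → (m :* (k :* k)) :* m := (m :* k) :* (m :* k)) refl (suc m) (suc k))
        (ℕ.m≤m*n (suc m ℕ.* (suc k ℕ.* suc k)) (suc m))

  -- Squares are compared to avoid roots. The approximations on the right are rounded down, so an
  -- error of order `1 / suc k` has to be absorbed by `ε`.
  2r²≤9n⇒≤ : 2 ℕ.* (r ℕ.* r) ℕ.≤ 9 ℕ.* n → fromℕ r ≤ fromℚ (+ 3 / 2) * √ 2 * √ n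
  2r²≤9n⇒≤ h ε 0<ε = let (N , small) = archimedean M ε 0<ε in N , λ k N≤k → begin
      + r / 1
        ≤⟨ /-mono r (3 ℕ.* a k ℕ.* b k ℕ.+ M ℕ.* (2 ℕ.* suc k)) 0 _
             (subst (r ℕ.* (2 ℕ.* suc k ℕ.* suc k) ℕ.≤_) (sym (ℕ.*-identityʳ _)) (key k)) ⟩
      + (3 ℕ.* a k ℕ.* b k ℕ.+ M ℕ.* (2 ℕ.* suc k)) / (2 ℕ.* suc k ℕ.* suc k)
        ≡⟨ /-+ (3 ℕ.* a k ℕ.* b k) (M ℕ.* (2 ℕ.* suc k)) _ ⟩
      + (3 ℕ.* a k ℕ.* b k) / (2 ℕ.* suc k ℕ.* suc k) ℚ.+ + (M ℕ.* (2 ℕ.* suc k)) / (2 ℕ.* suc k ℕ.* suc k)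
        ≤⟨ ℚ.+-mono-≤ (ℚ.≤-reflexive (trans (/-* (3 ℕ.* a k) (b k) _ k) (cong (ℚ._* √seq n k) (/-* 3 (a k) 1 k))))
             (/-mono (M ℕ.* (2 ℕ.* suc k)) M _ k (ℕ.≤-reflexive (ℕ.*-assoc M (2 ℕ.* suc k) (suc k)))) ⟩
      + 3 / 2 ℚ.* √seq 2 k ℚ.* √seq n k ℚ.+ + M / suc k
        ≤⟨ ℚ.+-monoʳ-≤ (+ 3 / 2 ℚ.* √seq 2 k ℚ.* √seq n k) (small k N≤k) ⟩
      + 3 / 2 ℚ.* √seq 2 k ℚ.* √seq n k ℚ.+ ε ∎
    where
    open ℚ.≤-Reasoning
    -- Rounding costs `3 * (1 + a k + b k)` in the numerator, and `1 + a k + b k` is at most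
    -- `(n + 3) * suc k`.
    M = 3 ℕ.* (n ℕ.+ 3)
    key : ∀ k → r ℕ.* (2 ℕ.* suc k ℕ.* suc k) ℕ.≤ 3 ℕ.* a k ℕ.* b k ℕ.+ M ℕ.* (2 ℕ.* suc k)
    key k = ℕR.begin
      r ℕ.* (2 ℕ.* κ ℕ.* κ)                            ℕR.≤⟨ square-cancel-≤ (r ℕ.* (2 ℕ.* κ ℕ.* κ))
                                                              (3 ℕ.* (suc (a k) ℕ.* suc (b k))) squares ⟩
      3 ℕ.* (suc (a k) ℕ.* suc (b k))                  ℕR.≡⟨ solve 2 (λ a b → con 3 :* ((con 1 :+ a) :* (con 1 :+ b))
                                                            := con 3 :* a :* b :+ con 3 :* (con 1 :+ a :+ b)) refl (a k) (b k) ⟩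
      3 ℕ.* a k ℕ.* b k ℕ.+ 3 ℕ.* (1 ℕ.+ a k ℕ.+ b k)  ℕR.≤⟨ ℕ.+-monoʳ-≤ (3 ℕ.* a k ℕ.* b k) (ℕ.*-monoʳ-≤ 3
                                                            (ℕ.+-mono-≤ (ℕ.+-mono-≤ (s≤s z≤n) (m√ 2 k)) (m√ n k))) ⟩
      3 ℕ.* a k ℕ.* b k ℕ.+ 3 ℕ.* (κ ℕ.+ 2 ℕ.* κ ℕ.+ n ℕ.* κ) ℕR.≡⟨ cong (3 ℕ.* a k ℕ.* b k ℕ.+_)
                                                            (solve 2 (λ n κ → con 3 :* (κ :+ con 2 :* κ :+ n :* κ)
                                                             := con 3 :* (n :+ con 3) :* κ) refl n κ) ⟩
      3 ℕ.* a k ℕ.* b k ℕ.+ M ℕ.* κ                    ℕR.≤⟨ ℕ.+-monoʳ-≤ (3 ℕ.* a k ℕ.* b k) (ℕ.*-monoʳ-≤ M (ℕ.m≤m+n κ _)) ⟩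
      3 ℕ.* a k ℕ.* b k ℕ.+ M ℕ.* (2 ℕ.* κ)            ℕR.∎
      where
      module ℕR = ℕ.≤-Reasoning
      κ = suc k
      squares : (r ℕ.* (2 ℕ.* κ ℕ.* κ)) ℕ.* (r ℕ.* (2 ℕ.* κ ℕ.* κ)) ℕ.≤
                (3 ℕ.* (suc (a k) ℕ.* suc (b k))) ℕ.* (3 ℕ.* (suc (a k) ℕ.* suc (b k)))
      squares = ℕR.begin
        (r ℕ.* (2 ℕ.* κ ℕ.* κ)) ℕ.* (r ℕ.* (2 ℕ.* κ ℕ.* κ))
          ℕR.≡⟨ solve 2 (λ r κ → (r :* (con 2 :* κ :* κ)) :* (r :* (con 2 :* κ :* κ))
                := (con 2 :* (r :* r)) :* (con 2 :* (κ :* κ) :* (κ :* κ))) refl r κ ⟩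
        (2 ℕ.* (r ℕ.* r)) ℕ.* (2 ℕ.* (κ ℕ.* κ) ℕ.* (κ ℕ.* κ))
          ℕR.≤⟨ ℕ.*-monoˡ-≤ (2 ℕ.* (κ ℕ.* κ) ℕ.* (κ ℕ.* κ)) h ⟩
        (9 ℕ.* n) ℕ.* (2 ℕ.* (κ ℕ.* κ) ℕ.* (κ ℕ.* κ))
          ℕR.≡⟨ solve 2 (λ n κ → (con 9 :* n) :* (con 2 :* (κ :* κ) :* (κ :* κ))
                := con 9 :* ((con 2 :* (κ :* κ)) :* (n :* (κ :* κ)))) refl n κ ⟩
        9 ℕ.* ((2 ℕ.* (κ ℕ.* κ)) ℕ.* (n ℕ.* (κ ℕ.* κ)))
          ℕR.≤⟨ ℕ.*-monoʳ-≤ 9 (ℕ.*-mono-≤ (ℕ.<⇒≤ (isqrt-upper (2 ℕ.* (κ ℕ.* κ)))) (ℕ.<⇒≤ (isqrt-upper (n ℕ.* (κ ℕ.* κ))))) ⟩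
        9 ℕ.* ((suc (a k) ℕ.* suc (a k)) ℕ.* (suc (b k) ℕ.* suc (b k)))
          ℕR.≡⟨ solve 2 (λ a b → con 9 :* ((a :* a) :* (b :* b))
                := (con 3 :* (a :* b)) :* (con 3 :* (a :* b))) refl (suc (a k)) (suc (b k)) ⟩
        (3 ℕ.* (suc (a k) ℕ.* suc (b k))) ℕ.* (3 ℕ.* (suc (a k) ℕ.* suc (b k))) ℕR.∎

  -- Rounding down now acts on the smaller side, so the inequality holds at every index.
  n≤2r²⇒≤ : n ℕ.≤ 2 ℕ.* (r ℕ.* r) → (fromℚ (+ 1 / 2) * √ 2 + 0ℝ) * √ n ≤ fromℕ r
  n≤2r²⇒≤ h ε 0<ε = 0 , λ k _ → begin
      (+ 1 / 2 ℚ.* √seq 2 k ℚ.+ 0ℚ) ℚ.* √seq n k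
        ≡⟨ cong (ℚ._* √seq n k) (trans (ℚ.+-identityʳ _) (sym (/-* 1 (a k) 1 k))) ⟩
      + (1 ℕ.* a k) / (2 ℕ.* suc k) ℚ.* √seq n k
        ≡⟨ /-* (1 ℕ.* a k) (b k) _ k ⟨
      + (1 ℕ.* a k ℕ.* b k) / (2 ℕ.* suc k ℕ.* suc k)
        ≤⟨ /-mono (1 ℕ.* a k ℕ.* b k) r _ 0
             (subst₂ ℕ._≤_ (sym (ℕ.*-identityʳ (1 ℕ.* a k ℕ.* b k))) refl
               (square-cancel-≤ (1 ℕ.* a k ℕ.* b k) (r ℕ.* (2 ℕ.* suc k ℕ.* suc k)) (squares k))) ⟩
      + r / 1
        ≤⟨ p≤p+ε (+ r / 1) 0<ε ⟩
      + r / 1 ℚ.+ ε ∎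
    where
    open ℚ.≤-Reasoning
    squares : ∀ k → (1 ℕ.* a k ℕ.* b k) ℕ.* (1 ℕ.* a k ℕ.* b k) ℕ.≤
                    (r ℕ.* (2 ℕ.* suc k ℕ.* suc k)) ℕ.* (r ℕ.* (2 ℕ.* suc k ℕ.* suc k))
    squares k = ℕR.begin
      (1 ℕ.* a k ℕ.* b k) ℕ.* (1 ℕ.* a k ℕ.* b k)
        ℕR.≡⟨ solve 2 (λ a b → (con 1 :* a :* b) :* (con 1 :* a :* b) := (a :* a) :* (b :* b)) refl (a k) (b k) ⟩
      (a k ℕ.* a k) ℕ.* (b k ℕ.* b k)
        ℕR.≤⟨ ℕ.*-mono-≤ (isqrt-lower (2 ℕ.* (κ ℕ.* κ))) (isqrt-lower (n ℕ.* (κ ℕ.* κ))) ⟩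
      (2 ℕ.* (κ ℕ.* κ)) ℕ.* (n ℕ.* (κ ℕ.* κ))
        ℕR.≤⟨ ℕ.*-monoʳ-≤ (2 ℕ.* (κ ℕ.* κ)) (ℕ.*-monoˡ-≤ (κ ℕ.* κ) h) ⟩
      (2 ℕ.* (κ ℕ.* κ)) ℕ.* (2 ℕ.* (r ℕ.* r) ℕ.* (κ ℕ.* κ))
        ℕR.≡⟨ solve 2 (λ r κ → (con 2 :* (κ :* κ)) :* (con 2 :* (r :* r) :* (κ :* κ))
              := (r :* (con 2 :* κ :* κ)) :* (r :* (con 2 :* κ :* κ))) refl r κ ⟩
      (r ℕ.* (2 ℕ.* κ ℕ.* κ)) ℕ.* (r ℕ.* (2 ℕ.* κ ℕ.* κ)) ℕR.∎
      where
      module ℕR = ℕ.≤-Reasoning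
      κ = suc k

  -- Since √2/2 ≤ 1, the coefficient is at most 0; this settles the small n.
  [½√2-1]√n≤ : (fromℚ (+ 1 / 2) * √ 2 + fromℚ (ℤ.-[1+ 0 ] / 1)) * √ n ≤ fromℕ r
  [½√2-1]√n≤ ε 0<ε = 0 , λ k _ → begin
      (+ 1 / 2 ℚ.* √seq 2 k ℚ.+ ℤ.-[1+ 0 ] / 1) ℚ.* √seq n k
        ≤⟨ ℚ.*-monoʳ-≤-nonNeg (√seq n k) {{ℚ.nonNegative (/-mono 0 (b k) 0 k z≤n)}} (ℚ.+-monoˡ-≤ (ℤ.-[1+ 0 ] / 1) (half≤1 k)) ⟩
      0ℚ ℚ.* √seq n k   ≡⟨ ℚ.*-zeroˡ (√seq n k) ⟩
      0ℚ                ≤⟨ /-mono 0 r 0 0 z≤n ⟩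
      + r / 1           ≤⟨ p≤p+ε (+ r / 1) 0<ε ⟩
      + r / 1 ℚ.+ ε     ∎
    where
    open ℚ.≤-Reasoning
    half≤1 : ∀ k → + 1 / 2 ℚ.* √seq 2 k ℚ.≤ + 1 / 1
    half≤1 k = subst (ℚ._≤ + 1 / 1) (/-* 1 (a k) 1 k) (/-mono (1 ℕ.* a k) 1 _ 0
      (subst₂ ℕ._≤_ (trans (sym (ℕ.*-identityˡ (a k))) (sym (ℕ.*-identityʳ (1 ℕ.* a k)))) (sym (ℕ.*-identityˡ (2 ℕ.* suc k))) (m√ 2 k)))

-- Any bound with r² + 24 r + 4 ≤ n whenever n₀ ≤ n and 2 r² < n will do.
n₀ : ℕ
n₀ = 1200

-- For `r ≤ 24` the left side is at most 24² + 24² + 4 = 1156; from 25 on, 24 r + 4 ≤ 25 r ≤ r².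
r²+24r+4≤ : ∀ {n} r → n₀ ℕ.≤ n → 2 ℕ.* (r ℕ.* r) ℕ.< n → r ℕ.* r ℕ.+ 24 ℕ.* r ℕ.+ 4 ℕ.≤ n
r²+24r+4≤ {n} r n₀≤n h with r ℕ.≤? 24
... | yes r≤ = ℕ.≤-trans (ℕ.+-monoˡ-≤ 4 (ℕ.+-mono-≤ (ℕ.*-mono-≤ r≤ r≤) (ℕ.*-monoʳ-≤ 24 r≤))) (ℕ.≤-trans (ℕ.m≤m+n 1156 44) n₀≤n)
... | no r≰ = begin
    r ℕ.* r ℕ.+ 24 ℕ.* r ℕ.+ 4     ≡⟨ ℕ.+-assoc (r ℕ.* r) (24 ℕ.* r) 4 ⟩
    r ℕ.* r ℕ.+ (24 ℕ.* r ℕ.+ 4)   ≤⟨ ℕ.+-monoʳ-≤ (r ℕ.* r) (ℕ.+-monoʳ-≤ (24 ℕ.* r) (ℕ.≤-trans (ℕ.m≤m+n 4 21) 25≤r)) ⟩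
    r ℕ.* r ℕ.+ (24 ℕ.* r ℕ.+ r)   ≡⟨ cong (r ℕ.* r ℕ.+_) (ℕ.+-comm (24 ℕ.* r) r) ⟩
    r ℕ.* r ℕ.+ 25 ℕ.* r           ≤⟨ ℕ.+-monoʳ-≤ (r ℕ.* r) (ℕ.*-monoˡ-≤ r 25≤r) ⟩
    r ℕ.* r ℕ.+ r ℕ.* r            ≡⟨ cong (r ℕ.* r ℕ.+_) (sym (ℕ.+-identityʳ (r ℕ.* r))) ⟩
    2 ℕ.* (r ℕ.* r)                ≤⟨ ℕ.<⇒≤ h ⟩
    n                              ∎
  where
  open ℕ.≤-Reasoning
  25≤r = ℕ.≰⇒> r≰

-- Combination of the two bounds

OddRamseyBounds : ∀ n → 3 ℕ.≤ n → Set
OddRamseyBounds n 3≤n = Σ ℕ λ r →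
  IsOddRamseyNumber (K n) (C n 3≤n) r × (n₀ ℕ.≤ n → n ℕ.≤ 2 ℕ.* (r ℕ.* r)) × 2 ℕ.* (r ℕ.* r) ℕ.≤ 9 ℕ.* n

least⇒bounds : ∀ {m} (3≤n : 3 ℕ.≤ suc m) → 2 ∣ suc m → ∀ {R} → 1 ℕ.≤ R → 2 ℕ.* (R ℕ.* R) ℕ.≤ 9 ℕ.* suc m →
               OddColourable (K (suc m)) (C (suc m) 3≤n) R → OddRamseyBounds (suc m) 3≤n
least⇒bounds {m} 3≤n 2∣n {R} 1≤R small odd =
  let (r , 1≤r , colourable , r≤R , minimal) = least (λ s → oddColourable? {m} {s} 3≤n) 1≤R odd
  in r , record { positive = 1≤r ; colourable = colourable ; minimal = minimal } ,
     (λ n₀≤n → ℕ.≮⇒≥ λ h → lower 3≤n 2∣n (r²+24r+4≤ r n₀≤n h) colourable) ,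
     ℕ.≤-trans (ℕ.*-monoʳ-≤ 2 (ℕ.*-mono-≤ r≤R r≤R)) small

oddRamsey : ∀ n (4≤n : 4 ℕ.≤ n) (3≤n : 3 ℕ.≤ n) → 2 ∣ n → OddRamseyBounds n 3≤n
oddRamsey (suc (suc N)) (s≤s (s≤s 2≤N)) 3≤n 2∣n =
  let (b , j , room , small) = balanced-rectangle N 2≤N
  in least⇒bounds 3≤n 2∣n (ℕ.≤-trans (ℕ.m^n>0 2 b) (ℕ.m≤m+n (2 ℕ.^ b) j))
       (ℕ.≤-trans small (ℕ.*-monoʳ-≤ 9 (ℕ.≤-trans (ℕ.n≤1+n N) (ℕ.n≤1+n (suc N)))))
       (Construction.odd {b = b} {j} 3≤n room)

-- The value -1 makes the coefficient √2/2 - 1 negative. The decision is an argument so that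
-- `vanishes` and `lower-bound` can match on it.
error : ∀ {n} → Dec (n₀ ℕ.≤ n) → ℝ
error (yes _) = 0ℝ
error (no _)  = fromℚ (ℤ.-[1+ 0 ] / 1)

theorem1p1 : Σ (Even≥4 → ℝ) λ ε → TendsToZero ε ×
    (∀ (n : Even≥4) → Σ ℕ λ r →
    IsOddRamseyNumber (K (value n)) (C (value n) (3≤ n)) r ×
    (fromℚ (+ 1 / 2) * √ 2 + ε n) * √ (value n) ≤ fromℕ r ×
    fromℕ r ≤ fromℚ (+ 3 / 2) * √ 2 * √ (value n))
theorem1p1 = (λ n → error (n₀ ℕ.≤? value n)) ,
  (λ δ 0<δ → n₀ , λ n n₀≤n → vanishes δ 0<δ (n₀ ℕ.≤? value n) n₀≤n) ,
  λ n → let (r , isR , lo , hi) = oddRamsey (value n) (4≤ n) (3≤ n) (even n)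
        in r , isR , lower-bound (value n) r (n₀ ℕ.≤? value n) lo , 2r²≤9n⇒≤ (value n) r hi
  where
  vanishes : ∀ δ → 0ℝ < δ → ∀ {n} (d : Dec (n₀ ℕ.≤ n)) → n₀ ℕ.≤ n → ∣ error d ∣ < δ
  vanishes δ 0<δ (yes _)    _    = 0<δ
  vanishes δ 0<δ (no n₀≰n) n₀≤n = contradiction n₀≤n n₀≰n
  lower-bound : ∀ n r (d : Dec (n₀ ℕ.≤ n)) → (n₀ ℕ.≤ n → n ℕ.≤ 2 ℕ.* (r ℕ.* r)) →
                (fromℚ (+ 1 / 2) * √ 2 + error d) * √ n ≤ fromℕ r
  lower-bound n r (yes n₀≤n) h = n≤2r²⇒≤ n r (h n₀≤n)
  lower-bound n r (no _)     h = [½√2-1]√n≤ n r
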